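{- There is an $O(1)$-competitive online algorithm for the hard $3$-taxi problem on the line; that is, there exist a constant $\rho$ and an online algorithm for the hard $3$-taxi problem on the metric space $\mathbb{R}$ with $d(x,y)=|x-y|$ that is $\rho$-competitive.
   Context: **Hard $k$-taxi problem** (here $k=3$). Let $(M,d)$ be a metric space. A configuration is a multiset of $k$ points of $M$ (the taxi positions). Given an initial configuration and a sequence of requests $\sigma=(r_1,\dots,r_n)$ with $r_i=(s_i,t_i)\in M^2$, an algorithm must move the taxis so as to serve the requests in order; a taxi serves $r_i$ by first moving to $s_i$ and then to $t_i$. The cost is the total distance travelled by all taxis, except that the movement of the serving taxi from $s_i$ to $t_i$ is not counted. An online algorithm must serve each request without knowledge of future requests. **Competitiveness.** An online algorithm $A$ is $\rho$-competitive if $E(\mathrm{cost}_A(\sigma))\le \rho\,\mathrm{OPT}(\sigma)+c$ for every request sequence $\sigma$ (the expectation is superfluous for deterministic algorithms), where $\mathrm{OPT}(\sigma)$ is the optimal offline cost of serving $\sigma$ from the same initial configuration and $c$ is a constant independent of $\sigma$. -}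

module Defs where

open import Algebra.Bundles using (CommutativeRing)
open import Algebra.Structures using (IsCommutativeRing)
import Algebra.Construct.NaturalChoice.Max as Max
import Algebra.Definitions.RawMonoid as RawMonoid
import Algebra.Properties.Ring as RingProperties
open import Data.Fin.Base using (Fin; zero; suc; toℕ; fromℕ<)
open import Data.List.Base using (List; []; _∷_; _∷ʳ_)
open import Data.List.Relation.Unary.All using (All; []; _∷_; universal)
open import Data.Nat.Base using (ℕ; zero; suc; NonZero; >-nonZero⁻¹)
open import Data.Product.Base using (Σ-syntax; ∃; ∃-syntax; _×_; _,_; proj₁; proj₂)
open import Data.Sum.Base using (inj₁; inj₂)
open import Data.Vec.Base using (Vec; lookup; replicate; _[_]≔_)
open import Data.Vec.Properties using (lookup-replicate)
open import Data.Vec.Functional using (Vector)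
open import Function.Metric.Structures using (IsGeneralMetric)
open import Level using (0ℓ) renaming (suc to lsuc)
open import Relation.Binary.Bundles using (TotalOrder)
open import Relation.Binary.Core using (Rel)
open import Relation.Binary.PropositionalEquality
  using (_≡_; _≢_; refl; sym; trans; cong; cong₂; subst; subst₂; isEquivalence)
open import Relation.Binary.Structures using (IsTotalOrder)
open import Relation.Unary using (Pred; U; ∁; ⋃; _≐_; _⊥_)

-- The real numbers, up to isomorphism: a Dedekind-complete ordered field.
record Reals : Set₁ where
  infix  8 -_
  infixl 7 _*_
  infixl 6 _+_ _-_
  infix  4 _≤_
  field
    ℝ                 : Set
    _+_ _*_           : ℝ → ℝ → ℝ
    -_                : ℝ → ℝ
    0# 1#             : ℝ
    _≤_               : Rel ℝ 0ℓ
    isCommutativeRing : IsCommutativeRing _≡_ _+_ _*_ -_ 0# 1#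
    0≢1               : 0# ≢ 1#
    inverse           : ∀ x → x ≢ 0# → ∃[ y ] x * y ≡ 1#
    isTotalOrder      : IsTotalOrder _≡_ _≤_
    +-monoˡ-≤         : ∀ z {x y} → x ≤ y → x + z ≤ y + z
    *-nonNeg          : ∀ {x y} → 0# ≤ x → 0# ≤ y → 0# ≤ x * y

  UpperBound : ∀ {ℓ} → Pred ℝ ℓ → ℝ → Set ℓ
  UpperBound S b = ∀ x → S x → x ≤ b

  LowerBound : ∀ {ℓ} → Pred ℝ ℓ → ℝ → Set ℓ
  LowerBound S b = ∀ x → S x → b ≤ x

  IsSupremum : ∀ {ℓ} → Pred ℝ ℓ → ℝ → Set ℓ
  IsSupremum S s = UpperBound S s × (∀ b → UpperBound S b → s ≤ b)

  IsInfimum : ∀ {ℓ} → Pred ℝ ℓ → ℝ → Set ℓ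
  IsInfimum S s = LowerBound S s × (∀ b → LowerBound S b → b ≤ s)

  field
    complete : (S : Pred ℝ 0ℓ) → ∃ S → ∃ (UpperBound S) → ∃ (IsSupremum S)

  commutativeRing : CommutativeRing 0ℓ 0ℓ
  commutativeRing = record { isCommutativeRing = isCommutativeRing }

  totalOrder : TotalOrder 0ℓ 0ℓ 0ℓ
  totalOrder = record { isTotalOrder = isTotalOrder }

  open IsCommutativeRing isCommutativeRing public
    using (+-assoc; +-comm; +-identityˡ; +-identityʳ; -‿inverseˡ; -‿inverseʳ)
  open IsTotalOrder isTotalOrder public
    using (total; antisym)
    renaming (refl to ≤-refl; trans to ≤-trans; reflexive to ≤-reflexive)
  open Max totalOrder public using (_⊔_; ⊔-lub; x≤x⊔y; x≤y⊔x; ⊔-idem)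
  open RawMonoid (CommutativeRing.+-rawMonoid commutativeRing) public using (sum)
  private module R = RingProperties (CommutativeRing.ring commutativeRing)

  _-_ : ℝ → ℝ → ℝ
  x - y = x + - y

  ∣_∣ : ℝ → ℝ
  ∣ x ∣ = x ⊔ (- x)

  infimum : (S : Pred ℝ 0ℓ) → ∃ S → ∃ (LowerBound S) → ∃ (IsInfimum S)
  infimum S (x , x∈S) bounded
    with s , ub , least ← complete (LowerBound S) bounded (x , λ b lb → lb x x∈S)
    = s , (λ y y∈S → least y (λ b lb → lb y y∈S)) , ub

  +-mono-≤ : ∀ {x y u v} → x ≤ y → u ≤ v → x + u ≤ y + v
  +-mono-≤ {x} {y} {u} {v} p q = ≤-trans (+-monoˡ-≤ u p)
    (subst₂ _≤_ (+-comm u y) (+-comm v y) (+-monoˡ-≤ y q))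

  +-nonNeg : ∀ {x y} → 0# ≤ x → 0# ≤ y → 0# ≤ x + y
  +-nonNeg {x} {y} p q = subst (_≤ x + y) (+-identityˡ 0#) (+-mono-≤ p q)

  sum-nonNeg : ∀ {n} (v : Vector ℝ n) → (∀ i → 0# ≤ v i) → 0# ≤ sum v
  sum-nonNeg {zero}  v p = ≤-refl
  sum-nonNeg {suc n} v p = +-nonNeg (p zero) (sum-nonNeg (λ i → v (suc i)) (λ i → p (suc i)))

  x≤0⇒0≤-x : ∀ {x} → x ≤ 0# → 0# ≤ - x
  x≤0⇒0≤-x {x} p = subst₂ _≤_ (-‿inverseʳ x) (+-identityˡ (- x)) (+-monoˡ-≤ (- x) p)

  ∣-∣-nonNeg : ∀ x → 0# ≤ ∣ x ∣
  ∣-∣-nonNeg x with total 0# x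
  ... | inj₁ 0≤x = ≤-trans 0≤x (x≤x⊔y x (- x))
  ... | inj₂ x≤0 = ≤-trans (x≤0⇒0≤-x x≤0) (x≤y⊔x x (- x))

  ∣-x∣≡∣x∣ : ∀ x → ∣ - x ∣ ≡ ∣ x ∣
  ∣-x∣≡∣x∣ x = antisym
    (⊔-lub (x≤y⊔x x (- x)) (subst (_≤ ∣ x ∣) (sym neg²) (x≤x⊔y x (- x))))
    (⊔-lub (subst (_≤ ∣ - x ∣) neg² (x≤y⊔x (- x) (- - x))) (x≤x⊔y (- x) (- - x)))
    where neg² = R.-‿involutive x

  ∣-∣-subadditive : ∀ x y → ∣ x + y ∣ ≤ ∣ x ∣ + ∣ y ∣
  ∣-∣-subadditive x y = ⊔-lub
    (+-mono-≤ (x≤x⊔y x (- x)) (x≤x⊔y y (- y)))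
    (subst (_≤ ∣ x ∣ + ∣ y ∣) (R.-‿+-comm x y) (+-mono-≤ (x≤y⊔x x (- x)) (x≤y⊔x y (- y))))

  ∣x∣≡0⇒x≡0 : ∀ {x} → ∣ x ∣ ≡ 0# → x ≡ 0#
  ∣x∣≡0⇒x≡0 {x} eq = antisym x≤0
    (subst (0# ≤_) (R.-‿involutive x) (x≤0⇒0≤-x (subst (- x ≤_) eq (x≤y⊔x x (- x)))))
    where x≤0 = subst (x ≤_) eq (x≤x⊔y x (- x))

  -‿-comm : ∀ x y → - (x - y) ≡ y - x
  -‿-comm x y = trans (sym (R.-‿+-comm x (- y)))
    (trans (cong (- x +_) (R.-‿involutive y)) (+-comm (- x) y))

  telescope : ∀ x y z → (x - y) + (y - z) ≡ x - z
  telescope x y z = trans (+-assoc x (- y) (y - z))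
    (cong (x +_) (trans (sym (+-assoc (- y) y (- z)))
      (trans (cong (_- z) (-‿inverseˡ y)) (+-identityˡ (- z)))))

  x-y≡0⇒x≡y : ∀ {x y} → x - y ≡ 0# → x ≡ y
  x-y≡0⇒x≡y {x} {y} = R.x∙y⁻¹≈ε⇒x≈y x y

module _ (R : Reals) where
  open Reals R

  record MetricSpace : Set₁ where
    field
      Point    : Set
      d        : Point → Point → ℝ
      isMetric : IsGeneralMetric _≡_ _≡_ _≤_ 0# _+_ d
    open IsGeneralMetric isMetric public using (nonNegative)

  line : MetricSpace
  line = record
    { Point    = ℝ
    ; d        = λ x y → ∣ x - y ∣
    ; isMetric = record
      { isSemiMetric = record
        { isQuasiSemiMetric = record
          { isPreMetric = record
            { isProtoMetric = record
              { isPartialOrder  = IsTotalOrder.isPartialOrder isTotalOrder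
              ; ≈-isEquivalence = isEquivalence
              ; cong            = cong₂ (λ x y → ∣ x - y ∣)
              ; nonNegative     = ∣-∣-nonNeg _
              }
            ; ≈⇒0 = λ { {x} refl → trans (cong ∣_∣ (-‿inverseʳ x)) ∣0∣≡0 }
            }
          ; 0⇒≈ = λ eq → x-y≡0⇒x≡y (∣x∣≡0⇒x≡0 eq)
          }
        ; sym = λ x y → trans (sym (∣-x∣≡∣x∣ (x - y))) (cong ∣_∣ (-‿-comm x y))
        }
      ; triangle = λ x y z → subst (_≤ ∣ x - y ∣ + ∣ y - z ∣)
                     (cong ∣_∣ (telescope x y z))
                     (∣-∣-subadditive (x - y) (y - z))
      }
    }
    where
    -0≡0 : - 0# ≡ 0#
    -0≡0 = trans (sym (+-identityˡ (- 0#))) (-‿inverseʳ 0#)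
    ∣0∣≡0 : ∣ 0# ∣ ≡ 0#
    ∣0∣≡0 = trans (cong (0# ⊔_) -0≡0) (⊔-idem 0#)

  -- P is total for convenience: its values off the σ-algebra carry no information.
  record ProbabilitySpace : Set₁ where
    field
      Ω            : Set
      Measurable   : Pred Ω 0ℓ → Set
      P            : Pred Ω 0ℓ → ℝ
      U-measurable : Measurable U
      ∁-measurable : ∀ {E} → Measurable E → Measurable (∁ E)
      ⋃-measurable : ∀ {E : ℕ → Pred Ω 0ℓ} → (∀ n → Measurable (E n)) → Measurable (⋃ ℕ E)
      -- Stand-ins for extensional equality of subsets.
      ≐-measurable : ∀ {E F} → E ≐ F → Measurable E → Measurable F
      P-cong       : ∀ {E F} → E ≐ F → Measurable E → P E ≡ P F
      P-nonNeg     : ∀ {E} → Measurable E → 0# ≤ P E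
      P-U          : P U ≡ 1#
      -- The series of a nonnegative sequence is the supremum of its partial sums.
      P-⋃          : ∀ {E : ℕ → Pred Ω 0ℓ} → (∀ n → Measurable (E n)) →
                     (∀ {m n} → m ≢ n → E m ⊥ E n) →
                     IsSupremum (λ s → ∃[ n ] s ≡ sum {n} (λ i → P (E (toℕ i)))) (P (⋃ ℕ E))

    -- Integrals of the nonnegative simple functions below X.
    LowerSum : (Ω → ℝ) → Pred ℝ (lsuc 0ℓ)
    LowerSum X s =
      Σ[ n ∈ ℕ ] Σ[ E ∈ Vector (Pred Ω 0ℓ) n ] Σ[ a ∈ Vector ℝ n ]
        (∀ i → Measurable (E i)) ×
        (∀ {i j} → i ≢ j → E i ⊥ E j) ×
        (∀ i → 0# ≤ a i) ×
        (∀ i ω → E i ω → a i ≤ X ω) ×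
        s ≡ sum (λ i → a i * P (E i))

    -- For nonnegative random variables only: X is measurable with Lebesgue integral e < ∞.
    IsExpectation : (Ω → ℝ) → ℝ → Set₁
    IsExpectation X e = (∀ b → Measurable (λ ω → X ω ≤ b)) × IsSupremum (LowerSum X) e

  module _ (M : MetricSpace) (k : ℕ) where
    open MetricSpace M

    -- A multiset of k points, with the taxis named by Fin k in order to track their movement.
    Config : Set
    Config = Vec Point k

    Request : Set
    Request = Point × Point

    distance : Config → Config → ℝ
    distance C D = sum (λ i → d (lookup C i) (lookup D i))

    -- The taxis move to `pickup`, the serving taxi is carried to the destination,
    -- and the taxis may then move on to `final`.
    record Service (r : Request) : Set where
      field
        pickup    : Config
        server    : Fin k
        at-source : lookup pickup server ≡ proj₁ r
        final     : Config

      dropoff : Config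
      dropoff = pickup [ server ]≔ proj₂ r

      cost-from : Config → ℝ
      cost-from C = distance C pickup + distance dropoff final

    open Service

    Schedule : List Request → Set
    Schedule = All Service

    cost : ∀ {σ} → Config → Schedule σ → ℝ
    cost C []       = 0#
    cost C (m ∷ ms) = cost-from m C + cost (final m) ms

    cost-nonNeg : ∀ {σ} C (ms : Schedule σ) → 0# ≤ cost C ms
    cost-nonNeg C []       = ≤-refl
    cost-nonNeg C (m ∷ ms) = +-nonNeg
      (+-nonNeg (sum-nonNeg {k} _ (λ _ → nonNegative)) (sum-nonNeg {k} _ (λ _ → nonNegative)))
      (cost-nonNeg (final m) ms)

    module _ .{{_ : NonZero k}} where

      some-schedule : ∀ σ → Schedule σ
      some-schedule = universal λ (s , t) → record
        { pickup    = replicate k s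
        ; server    = fromℕ< (>-nonZero⁻¹ k)
        ; at-source = lookup-replicate (fromℕ< (>-nonZero⁻¹ k)) s
        ; final     = replicate k s
        }

      OPT-infimum : ∀ C σ → ∃ (IsInfimum (λ v → Σ[ ms ∈ Schedule σ ] v ≡ cost C ms))
      OPT-infimum C σ = infimum _ (_ , some-schedule σ , refl)
        (0# , λ { _ (ms , refl) → cost-nonNeg C ms })

      OPT : Config → List Request → ℝ
      OPT C σ = proj₁ (OPT-infimum C σ)

    -- The reaction to a request r, given the initial configuration and the requests before r.
    DeterministicOnlineAlgorithm : Set
    DeterministicOnlineAlgorithm = Config → List Request → (r : Request) → Service r

    run : DeterministicOnlineAlgorithm → Config → (σ : List Request) → Schedule σ
    run A C = go []
      where
      go : List Request → (σ : List Request) → Schedule σ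
      go past []      = []
      go past (r ∷ σ) = A C past r ∷ go (past ∷ʳ r) σ

    -- Possibly randomized; a deterministic algorithm is the case of a one-point space.
    record OnlineAlgorithm : Set₁ where
      field
        space  : ProbabilitySpace
      open ProbabilitySpace space public
      field
        sample : Ω → DeterministicOnlineAlgorithm

      cost-on : Config → List Request → Ω → ℝ
      cost-on C σ ω = cost C (run (sample ω) C σ)

    IsCompetitive : .{{NonZero k}} → ℝ → OnlineAlgorithm → Set₁
    IsCompetitive ρ A =
      ∀ C → ∃[ c ] ∀ σ → ∃[ e ] IsExpectation (cost-on C σ) e × e ≤ ρ * OPT C σ + c
      where open OnlineAlgorithm A

{-# OPTIONS --safe #-}
module Submission where

-- After each request, online and offline algorithm may be assumed to have a taxi at the same point
-- p, so that only the pairs of the other two taxis matter; their matching distance grows by at most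
-- the costs paid, however passengers are carried. To serve a request at s, one either pays the
-- distance of p and s, or brings another taxi to s, and the one at p takes its place.
--
-- The pursuit by one slot is the 2-taxi algorithm that moves the taxi of that slot and the one at p
-- and ignores the third. If two offline strategies X and Z stay far apart compared to their total
-- cost K, then whenever neither serves from p, both serve by taxis that nearly coincide, and always
-- by the same ones up to such coincidences, since otherwise X and Z would be close. Hence one of
-- the two pursuits costs only O(K), plus the distance of its start from that of X.
--
-- So, starting from Y with an uncertainty z, follow the cheaper of both pursuits until both have
-- cost much more than a least v ≥ z for which some strategy X starts within v of Y and costs O(v).
-- Then the offline taxis are close to X unless the offline algorithm has itself paid Ω(v): move to
-- X and start again with uncertainty v / 4. The potential is z plus the distance of Y from the
-- offline taxis.

open import Defs
open import Axiom.ExcludedMiddle using (ExcludedMiddle)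
open import Data.Nat.Base using (nonZero)
open import Data.Product.Base using (∃-syntax)
open import Level using (0ℓ)

open import Algebra.Bundles using (CommutativeRing)
import Algebra.Properties.Ring as RingProperties
open import Algebra.Structures using (IsCommutativeRing)
open import Data.Empty using (⊥-elim)
open import Data.Fin.Base using (Fin; zero; suc; toℕ; fromℕ)
open import Data.Fin.Properties using (suc-injective; toℕ-injective; toℕ-fromℕ)
open import Data.List.Base using (List; []; _∷_; _∷ʳ_; foldl)
open import Data.List.Properties using (foldl-∷ʳ)
open import Data.List.Relation.Unary.All using ([]; _∷_)
open import Data.Nat.Base using (ℕ; zero; suc) renaming (_+_ to _+ₙ_; _*_ to _*ₙ_)
open import Data.Product.Base using (∃; _×_; _,_; proj₁; proj₂)
open import Data.Sum.Base using (_⊎_; inj₁; inj₂)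
open import Data.Unit.Base using (⊤; tt)
open import Data.Vec.Base using (Vec; []; _∷_; lookup; zipWith; replicate; allFin)
  renaming (map to mapᵛ; _[_]≔_ to updateᵛ)
open import Data.Vec.Functional using (Vector)
open import Data.Vec.N-ary using (N-ary; _$ⁿ_; curryⁿ; ∀ⁿʰ)
open import Function.Base using (_∋_)
open import Function.Metric.Structures using (IsGeneralMetric)
open import Relation.Binary.PropositionalEquality
  using (_≡_; _≢_; refl; sym; trans; cong; cong₂; subst; subst₂; module ≡-Reasoning)
open import Relation.Nullary using (Dec; yes; no; ¬_)
open import Relation.Unary using (Pred; U; ⋃; _⊥_)

-- Inequalities between linear forms with coefficients in ℕ, proved from hypotheses lᵢ ≤ rᵢ by
-- multipliers kᵢ and m ≥ 1 such that m L + Σ kᵢ rᵢ and m R + Σ kᵢ lᵢ are the same form.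
module LinearArithmetic (R : Reals) where
  open Reals R
  open ≡-Reasoning

  infixr 7 _⋆_
  -- Opaque, so that multiples by constants such as 40000 are never unfolded; `zero-⋆` and `suc-⋆`
  -- are the only access.
  opaque
    _⋆_ : ℕ → ℝ → ℝ
    zero  ⋆ x = 0#
    suc n ⋆ x = x + n ⋆ x

    zero-⋆ : ∀ x → 0 ⋆ x ≡ 0#
    zero-⋆ x = refl

    suc-⋆ : ∀ n x → suc n ⋆ x ≡ x + n ⋆ x
    suc-⋆ n x = refl

  +-interchange : ∀ a b c e → (a + b) + (c + e) ≡ (a + c) + (b + e)
  +-interchange a b c e = begin
    (a + b) + (c + e) ≡⟨ +-assoc a b (c + e) ⟩
    a + (b + (c + e)) ≡⟨ cong (a +_) (+-assoc b c e) ⟨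
    a + ((b + c) + e) ≡⟨ cong (λ z → a + (z + e)) (+-comm b c) ⟩
    a + ((c + b) + e) ≡⟨ cong (a +_) (+-assoc c b e) ⟩
    a + (c + (b + e)) ≡⟨ +-assoc a c (b + e) ⟨
    (a + c) + (b + e) ∎

  ⋆-distrib-+ : ∀ n x y → n ⋆ (x + y) ≡ n ⋆ x + n ⋆ y
  ⋆-distrib-+ zero    x y rewrite zero-⋆ (x + y) | zero-⋆ x | zero-⋆ y = sym (+-identityˡ 0#)
  ⋆-distrib-+ (suc n) x y
    rewrite suc-⋆ n (x + y) | suc-⋆ n x | suc-⋆ n y | ⋆-distrib-+ n x y = +-interchange x y _ _

  +-⋆ : ∀ m n x → (m +ₙ n) ⋆ x ≡ m ⋆ x + n ⋆ x
  +-⋆ zero    n x rewrite zero-⋆ x = sym (+-identityˡ _)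
  +-⋆ (suc m) n x rewrite suc-⋆ (m +ₙ n) x | suc-⋆ m x | +-⋆ m n x = sym (+-assoc x _ _)

  ⋆-zero : ∀ n → n ⋆ 0# ≡ 0#
  ⋆-zero zero    = zero-⋆ 0#
  ⋆-zero (suc n) rewrite suc-⋆ n 0# | ⋆-zero n = +-identityˡ 0#

  *-⋆ : ∀ m n x → (m *ₙ n) ⋆ x ≡ m ⋆ (n ⋆ x)
  *-⋆ zero    n x rewrite zero-⋆ x | zero-⋆ (n ⋆ x) = refl
  *-⋆ (suc m) n x rewrite +-⋆ n (m *ₙ n) x | suc-⋆ m (n ⋆ x) | *-⋆ m n x = refl

  ⋆-mono-≤ : ∀ n {x y} → x ≤ y → n ⋆ x ≤ n ⋆ y
  ⋆-mono-≤ zero    {x} {y} p rewrite zero-⋆ x | zero-⋆ y = ≤-refl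
  ⋆-mono-≤ (suc n) {x} {y} p rewrite suc-⋆ n x | suc-⋆ n y = +-mono-≤ p (⋆-mono-≤ n p)

  +-cancelʳ-≤ : ∀ z {x y} → x + z ≤ y + z → x ≤ y
  +-cancelʳ-≤ z {x} {y} p = subst₂ _≤_ (cancel x) (cancel y) (+-monoˡ-≤ (- z) p)
    where
    cancel : ∀ u → u + z + - z ≡ u
    cancel u = trans (+-assoc u z (- z)) (trans (cong (u +_) (-‿inverseʳ z)) (+-identityʳ u))

  -- By totality: if y ≤ x, then x + n ⋆ x ≤ y + n ⋆ y ≤ y + n ⋆ x, and n ⋆ x cancels.
  ⋆-cancel-≤ : ∀ n {x y} → suc n ⋆ x ≤ suc n ⋆ y → x ≤ y
  ⋆-cancel-≤ n {x} {y} p with total x y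
  ... | inj₁ x≤y = x≤y
  ... | inj₂ y≤x = +-cancelʳ-≤ (n ⋆ x)
    (≤-trans (subst₂ _≤_ (suc-⋆ n x) (suc-⋆ n y) p) (+-mono-≤ ≤-refl (⋆-mono-≤ n y≤x)))

  -- Linear inequalities as syntax, and their certificates.

  infixl 6 _:+_
  infixr 7 _:⋆_
  infix  4 _:≤_
  infixr 3 _⇒_
  infix  3 ⊢_

  data Expr (n : ℕ) : Set where
    var  : Fin n → Expr n
    :0   : Expr n
    _:+_ : Expr n → Expr n → Expr n
    _:⋆_ : ℕ → Expr n → Expr n

  data Inequality (n : ℕ) : Set where
    _:≤_ : Expr n → Expr n → Inequality n

  data Sequent (n : ℕ) : Set where
    ⊢_  : Inequality n → Sequent n
    _⇒_ : Inequality n → Sequent n → Sequent n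

  Form : ℕ → Set
  Form = Vec ℕ

  module _ {n : ℕ} where
    infixl 6 _+ᶠ_

    0ᶠ : Form n
    0ᶠ = replicate n 0

    _+ᶠ_ : Form n → Form n → Form n
    _+ᶠ_ = zipWith _+ₙ_

    _⋆ᶠ_ : ℕ → Form n → Form n
    k ⋆ᶠ f = mapᵛ (k *ₙ_) f

  unit : ∀ {n} → Fin n → Form n
  unit zero    = 1 ∷ 0ᶠ
  unit (suc i) = 0 ∷ unit i

  form : ∀ {n} → Expr n → Form n
  form (var i)   = unit i
  form :0        = 0ᶠ
  form (a :+ b)  = form a +ᶠ form b
  form (k :⋆ a)  = k ⋆ᶠ form a

  eval : ∀ {n} → Vec ℝ n → Form n → ℝ
  eval []      []      = 0#
  eval (x ∷ ρ) (k ∷ f) = k ⋆ x + eval ρ f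

  eval-0 : ∀ {n} (ρ : Vec ℝ n) → eval ρ 0ᶠ ≡ 0#
  eval-0 []      = refl
  eval-0 (x ∷ ρ) rewrite zero-⋆ x | eval-0 ρ = +-identityˡ 0#

  eval-+ : ∀ {n} (ρ : Vec ℝ n) f g → eval ρ (f +ᶠ g) ≡ eval ρ f + eval ρ g
  eval-+ []      []      []      = sym (+-identityˡ 0#)
  eval-+ (x ∷ ρ) (k ∷ f) (l ∷ g) rewrite +-⋆ k l x | eval-+ ρ f g = +-interchange _ _ _ _

  eval-⋆ : ∀ {n} (ρ : Vec ℝ n) k f → eval ρ (k ⋆ᶠ f) ≡ k ⋆ eval ρ f
  eval-⋆ []      k []      = sym (⋆-zero k)
  eval-⋆ (x ∷ ρ) k (l ∷ f) rewrite *-⋆ k l x | eval-⋆ ρ k f = sym (⋆-distrib-+ k _ _)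

  eval-unit : ∀ {n} (ρ : Vec ℝ n) i → eval ρ (unit i) ≡ lookup ρ i
  eval-unit (x ∷ ρ) zero rewrite suc-⋆ 0 x | zero-⋆ x | eval-0 ρ =
    trans (+-identityʳ _) (+-identityʳ x)
  eval-unit (x ∷ ρ) (suc i) rewrite zero-⋆ x | eval-unit ρ i = +-identityˡ _

  module _ {n : ℕ} (ρ : Vec ℝ n) where

    ⟦_⟧ : Expr n → ℝ
    ⟦ var i ⟧  = lookup ρ i
    ⟦ :0 ⟧     = 0#
    ⟦ a :+ b ⟧ = ⟦ a ⟧ + ⟦ b ⟧
    ⟦ k :⋆ a ⟧ = k ⋆ ⟦ a ⟧

    eval-form : ∀ a → eval ρ (form a) ≡ ⟦ a ⟧
    eval-form (var i)  = eval-unit ρ i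
    eval-form :0       = eval-0 ρ
    eval-form (a :+ b) rewrite eval-+ ρ (form a) (form b) | eval-form a | eval-form b = refl
    eval-form (k :⋆ a) rewrite eval-⋆ ρ k (form a) | eval-form a = refl

    Holds : Sequent n → Set
    Holds (⊢ a :≤ b)     = ⟦ a ⟧ ≤ ⟦ b ⟧
    Holds (a :≤ b ⇒ s) = ⟦ a ⟧ ≤ ⟦ b ⟧ → Holds s

  multiplier : List ℕ → ℕ
  multiplier []      = 0
  multiplier (m ∷ _) = m

  -- The multipliers of the hypotheses come first, then m - 1, where missing entries are 0.
  Certified : ∀ {n} → Sequent n → List ℕ → Form n → Form n → Set
  Certified (⊢ a :≤ b)   ks f g =
    suc (multiplier ks) ⋆ᶠ form a +ᶠ g ≡ suc (multiplier ks) ⋆ᶠ form b +ᶠ f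
  Certified (a :≤ b ⇒ s) []       f g = Certified s [] f g
  Certified (a :≤ b ⇒ s) (k ∷ ks) f g = Certified s ks (f +ᶠ k ⋆ᶠ form a) (g +ᶠ k ⋆ᶠ form b)

  -- The accumulators f and g collect Σ kᵢ lᵢ and Σ kᵢ rᵢ, so that f ≤ g in value. At the
  -- conclusion, m a + g = m b + f ≤ m b + g, where g and m cancel.
  certified⇒holds : ∀ {n} (ρ : Vec ℝ n) s ks f g →
                    Certified s ks f g → eval ρ f ≤ eval ρ g → Holds ρ s
  certified⇒holds ρ (⊢ a :≤ b) ks f g cert f≤g =
    ⋆-cancel-≤ m (+-cancelʳ-≤ (eval ρ g) (subst (_≤ suc m ⋆ B + eval ρ g) (sym equal)
      (+-mono-≤ ≤-refl f≤g)))
    where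
    m = multiplier ks
    A = ⟦ ρ ⟧ a
    B = ⟦ ρ ⟧ b
    side : ∀ c h → eval ρ (suc m ⋆ᶠ form c +ᶠ h) ≡ suc m ⋆ ⟦ ρ ⟧ c + eval ρ h
    side c h rewrite eval-+ ρ (suc m ⋆ᶠ form c) h | eval-⋆ ρ (suc m) (form c) | eval-form ρ c = refl
    equal : suc m ⋆ A + eval ρ g ≡ suc m ⋆ B + eval ρ f
    equal = trans (sym (side a g)) (trans (cong (eval ρ) cert) (side b f))
  certified⇒holds ρ (a :≤ b ⇒ s) []       f g cert f≤g _   = certified⇒holds ρ s [] f g cert f≤g
  certified⇒holds ρ (a :≤ b ⇒ s) (k ∷ ks) f g cert f≤g a≤b = certified⇒holds ρ s ks _ _ cert
    (subst₂ _≤_ (sym (side f a)) (sym (side g b)) (+-mono-≤ f≤g (⋆-mono-≤ k a≤b)))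
    where
    side : ∀ h c → eval ρ (h +ᶠ k ⋆ᶠ form c) ≡ eval ρ h + k ⋆ ⟦ ρ ⟧ c
    side h c rewrite eval-+ ρ h (k ⋆ᶠ form c) | eval-⋆ ρ k (form c) | eval-form ρ c = refl

  ∀ⁿʰ-intro : ∀ n {P : Vec ℝ n → Set} → (∀ ρ → P ρ) → ∀ⁿʰ n (curryⁿ P)
  ∀ⁿʰ-intro zero    p = p []
  ∀ⁿʰ-intro (suc n) p = ∀ⁿʰ-intro n (λ ρ → p (_ ∷ ρ))

  instantiate : ∀ n → N-ary n (Expr n) (Sequent n) → Sequent n
  instantiate n s = s $ⁿ mapᵛ var (allFin n)

  -- The forms are closed vectors of numerals, so that `refl` proves the certificate.
  linear : ∀ n (s : N-ary n (Expr n) (Sequent n)) ks → Certified (instantiate n s) ks 0ᶠ 0ᶠ →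
           ∀ⁿʰ n (curryⁿ (λ ρ → Holds ρ (instantiate n s)))
  linear n s ks cert = ∀ⁿʰ-intro n (λ ρ → certified⇒holds ρ (instantiate n s) ks 0ᶠ 0ᶠ cert ≤-refl)

-- Distances on the line.

module Distance (R : Reals) where
  open Reals R
  open LinearArithmetic R
  private module Line = IsGeneralMetric (MetricSpace.isMetric (line R))

  d : ℝ → ℝ → ℝ
  d x y = ∣ x - y ∣

  d-nonNeg : ∀ x y → 0# ≤ d x y
  d-nonNeg x y = ∣-∣-nonNeg (x - y)

  d-sym : ∀ x y → d x y ≡ d y x
  d-sym = Line.sym

  d-swap : ∀ x y → d x y ≤ d y x
  d-swap x y = ≤-reflexive (d-sym x y)

  d-self : ∀ x → d x x ≤ 0#
  d-self x = ≤-reflexive (Line.≈⇒0 refl)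

  triangle : ∀ x y z → d x z ≤ d x y + d y z
  triangle = Line.triangle

  triangle₃ : ∀ w x y z → d w z ≤ d w x + d x y + d y z
  triangle₃ w x y z = ≤-trans (triangle w y z) (+-monoˡ-≤ (d y z) (triangle w x y))

  triangle₅ : ∀ u v w x y z → d u z ≤ d u v + d v w + d w x + d x y + d y z
  triangle₅ u v w x y z =
    linear 7 (λ uz ux uv vw wx xy yz → uz :≤ ux :+ xy :+ yz ⇒ ux :≤ uv :+ vw :+ wx ⇒
      ⊢ uz :≤ uv :+ vw :+ wx :+ xy :+ yz) (1 ∷ 1 ∷ []) refl
      (triangle₃ u x y z) (triangle₃ u v w x)

  minus-plus : ∀ x y → x - y + y ≡ x
  minus-plus x y =
    trans (+-assoc x (- y) y) (trans (cong (x +_) (-‿inverseˡ y)) (+-identityʳ x))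

  ≤-minus : ∀ {x y e} → x ≤ y + e → x - y ≤ e
  ≤-minus {x} {y} {e} p =
    linear 4 (λ x y e f → x :≤ y :+ e ⇒ f :+ y :≤ x ⇒ ⊢ f :≤ e) (1 ∷ 1 ∷ []) refl
      p (≤-reflexive (minus-plus x y))

  d-intro : ∀ {x y e} → x ≤ y + e → y ≤ x + e → d x y ≤ e
  d-intro {x} {y} {e} p q =
    ⊔-lub (≤-minus p) (subst (_≤ e) (sym (-‿-comm x y)) (≤-minus q))

  d-elim : ∀ x y → x ≤ y + d x y
  d-elim x y =
    linear 4 (λ x y e f → x :≤ f :+ y ⇒ f :≤ e ⇒ ⊢ x :≤ y :+ e) (1 ∷ 1 ∷ []) refl
      (≤-reflexive (sym (minus-plus x y))) (x≤x⊔y (x - y) (- (x - y)))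

  -- Besides the axioms of a metric, the only property of the line that the algorithm needs.
  towards : ∀ x y {e} → 0# ≤ e → e ≤ d x y → ∃[ z ] d x z ≤ e × d z y + e ≤ d x y
  towards x y {e} 0≤e e≤d with total x y
  ... | inj₁ x≤y = x + e , d-intro (linear 2 (λ x e → :0 :≤ e ⇒ ⊢ x :≤ x :+ e :+ e) (2 ∷ []) refl
    0≤e) ≤-refl ,
    linear 4 (λ h g e D → h :≤ g ⇒ g :+ e :≤ D ⇒ ⊢ h :+ e :≤ D) (1 ∷ 1 ∷ []) refl
      (d-intro
        (linear 6 (λ x y e f g D → e :≤ D ⇒ D :≤ f ⇒ f :+ x :≤ y ⇒ D :≤ g :+ e ⇒
          ⊢ x :+ e :≤ y :+ g) (2 ∷ 1 ∷ 1 ∷ 1 ∷ []) refl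
          e≤d d≤y-x (≤-reflexive (minus-plus y x)) (≤-reflexive (sym (minus-plus (d x y) e))))
        (linear 6 (λ x y e g D E → y :≤ x :+ E ⇒ E :≤ D ⇒ D :≤ g :+ e ⇒ ⊢ y :≤ x :+ e :+ g)
          (1 ∷ 1 ∷ 1 ∷ []) refl
          (d-elim y x) (d-swap y x) (≤-reflexive (sym (minus-plus (d x y) e)))))
      (≤-reflexive (minus-plus (d x y) e))
    where
    d≤y-x : d x y ≤ y - x
    d≤y-x = d-intro
      (linear 3 (λ x y f → x :≤ y ⇒ y :≤ f :+ x ⇒ ⊢ x :≤ y :+ f) (2 ∷ 1 ∷ []) refl
        x≤y (≤-reflexive (sym (minus-plus y x))))
      (linear 3 (λ x y f → y :≤ f :+ x ⇒ ⊢ y :≤ x :+ f) (1 ∷ []) refl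
        (≤-reflexive (sym (minus-plus y x))))
  ... | inj₂ y≤x = x - e , d-intro
      (linear 3 (λ x z e → x :≤ z :+ e ⇒ ⊢ x :≤ z :+ e) (1 ∷ []) refl
        (≤-reflexive (sym (minus-plus x e))))
      (linear 3 (λ x z e → :0 :≤ e ⇒ z :+ e :≤ x ⇒ ⊢ z :≤ x :+ e) (2 ∷ 1 ∷ []) refl
        0≤e (≤-reflexive (minus-plus x e))) ,
    linear 4 (λ h g e D → h :≤ g ⇒ g :+ e :≤ D ⇒ ⊢ h :+ e :≤ D) (1 ∷ 1 ∷ []) refl
      (d-intro
        (linear 6 (λ x y z e g D → z :+ e :≤ x ⇒ x :≤ y :+ D ⇒ D :≤ g :+ e ⇒ ⊢ z :≤ y :+ g)
          (1 ∷ 1 ∷ 1 ∷ []) refl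
          (≤-reflexive (minus-plus x e)) (d-elim x y) (≤-reflexive (sym (minus-plus (d x y) e))))
        (linear 7 (λ x y z e f g D → e :≤ D ⇒ D :≤ f ⇒ f :+ y :≤ x ⇒ x :≤ z :+ e ⇒ D :≤ g :+ e ⇒
          ⊢ y :≤ z :+ g) (2 ∷ 1 ∷ 1 ∷ 1 ∷ 1 ∷ []) refl
          e≤d d≤x-y (≤-reflexive (minus-plus x y)) (≤-reflexive (sym (minus-plus x e)))
          (≤-reflexive (sym (minus-plus (d x y) e)))))
      (≤-reflexive (minus-plus (d x y) e))
    where
    d≤x-y : d x y ≤ x - y
    d≤x-y = d-intro
      (linear 3 (λ x y f → x :≤ f :+ y ⇒ ⊢ x :≤ y :+ f) (1 ∷ []) refl
        (≤-reflexive (sym (minus-plus x y))))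
      (linear 3 (λ x y f → y :≤ x ⇒ x :≤ f :+ y ⇒ ⊢ y :≤ x :+ f) (2 ∷ 1 ∷ []) refl
        y≤x (≤-reflexive (sym (minus-plus x y))))

-- Order and division in the field.

module OrderedField (R : Reals) where
  open Reals R
  open LinearArithmetic R
  private module Ring = RingProperties (CommutativeRing.ring commutativeRing)
  open IsCommutativeRing isCommutativeRing using (distribˡ; *-identityʳ; *-comm; *-assoc; zeroʳ)

  0≤1 : 0# ≤ 1#
  0≤1 with total 0# 1#
  ... | inj₁ p = p
  ... | inj₂ p = subst (0# ≤_) (begin
    - 1# * - 1#   ≡⟨ Ring.-‿distribˡ-* 1# (- 1#) ⟨
    - (1# * - 1#) ≡⟨ Ring.-‿distribʳ-* 1# (- 1#) ⟩
    1# * - - 1#   ≡⟨ cong (1# *_) (Ring.-‿involutive 1#) ⟩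
    1# * 1#       ≡⟨ *-identityʳ 1# ⟩
    1#            ∎) (*-nonNeg (x≤0⇒0≤-x p) (x≤0⇒0≤-x p))
    where open ≡-Reasoning

  *-⋆ʳ : ∀ n x y → x * (n ⋆ y) ≡ n ⋆ (x * y)
  *-⋆ʳ zero    x y rewrite zero-⋆ y | zero-⋆ (x * y) = zeroʳ x
  *-⋆ʳ (suc n) x y rewrite suc-⋆ n y | suc-⋆ n (x * y) | distribˡ x y (n ⋆ y) | *-⋆ʳ n x y = refl

  ⋆1-* : ∀ n x → (n ⋆ 1#) * x ≡ n ⋆ x
  ⋆1-* n x = trans (*-comm (n ⋆ 1#) x) (trans (*-⋆ʳ n x 1#) (cong (n ⋆_) (*-identityʳ x)))

  suc-⋆1≢0 : ∀ n → suc n ⋆ 1# ≢ 0#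
  suc-⋆1≢0 n eq = 0≢1 (antisym 0≤1 (≤-trans 1≤n+1 (≤-reflexive eq)))
    where
    1≤n+1 : 1# ≤ suc n ⋆ 1#
    1≤n+1 rewrite suc-⋆ n 1# =
      linear 2 (λ a b → :0 :≤ b ⇒ ⊢ a :≤ a :+ b) (1 ∷ []) refl
        (subst (_≤ n ⋆ 1#) (⋆-zero n) (⋆-mono-≤ n 0≤1))

  divide : ∀ n x → ∃[ y ] suc n ⋆ y ≡ x
  divide n x with i , eq ← inverse (suc n ⋆ 1#) (suc-⋆1≢0 n) = i * x , (begin
    suc n ⋆ (i * x)          ≡⟨ ⋆1-* (suc n) (i * x) ⟨
    (suc n ⋆ 1#) * (i * x)   ≡⟨ *-assoc (suc n ⋆ 1#) i x ⟨
    (suc n ⋆ 1#) * i * x     ≡⟨ cong (_* x) eq ⟩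
    1# * x                   ≡⟨ *-comm 1# x ⟩
    x * 1#                   ≡⟨ *-identityʳ x ⟩
    x                        ∎)
    where open ≡-Reasoning

-- Strategies on pairs of taxis and their matching distance.

module Game (R : Reals) where
  open Reals R
  open LinearArithmetic R
  open Distance R

  data Side : Set where
    left right : Side

  flip : Side → Side
  flip left  = right
  flip right = left

  flip-involutive : ∀ i → flip (flip i) ≡ i
  flip-involutive left  = refl
  flip-involutive right = refl

  same-or-flip : ∀ i j → i ≡ j ⊎ flip i ≡ j
  same-or-flip left  left  = inj₁ refl
  same-or-flip left  right = inj₂ refl
  same-or-flip right left  = inj₂ refl
  same-or-flip right right = inj₁ refl

  Pair : Set
  Pair = ℝ × ℝ

  infixl 9 _‼_ _[_≔_]

  _‼_ : Pair → Side → ℝ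
  (x , y) ‼ left  = x
  (x , y) ‼ right = y

  _[_≔_] : Pair → Side → ℝ → Pair
  (x , y) [ left  ≔ z ] = z , y
  (x , y) [ right ≔ z ] = x , z

  ‼-update : ∀ X i z → X [ i ≔ z ] ‼ i ≡ z
  ‼-update X left  z = refl
  ‼-update X right z = refl

  ‼-update-flip : ∀ X i z → X [ i ≔ z ] ‼ flip i ≡ X ‼ flip i
  ‼-update-flip X left  z = refl
  ‼-update-flip X right z = refl

  -- The cost of one of the two matchings of X with Z, selected by whether i and j agree.
  gap : Pair → Pair → Side → Side → ℝ
  gap X Z i j = d (X ‼ i) (Z ‼ j) + d (X ‼ flip i) (Z ‼ flip j)

  gap-flip : ∀ X Z i j → gap X Z (flip i) (flip j) ≡ gap X Z i j
  gap-flip X Z left  left  = +-comm _ _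
  gap-flip X Z left  right = +-comm _ _
  gap-flip X Z right left  = +-comm _ _
  gap-flip X Z right right = +-comm _ _

  gap-diagonal : ∀ X Z i → gap X Z i i ≡ gap X Z left left
  gap-diagonal X Z left  = refl
  gap-diagonal X Z right = +-comm _ _

  gap-nonNeg : ∀ X Z i j → 0# ≤ gap X Z i j
  gap-nonNeg X Z i j = +-nonNeg (d-nonNeg _ _) (d-nonNeg _ _)

  gap-component : ∀ X Z i j → d (X ‼ j) (Z ‼ j) ≤ gap X Z i i
  gap-component X Z i j rewrite gap-diagonal X Z i | sym (gap-diagonal X Z j) =
    linear 2 (λ a b → :0 :≤ b ⇒ ⊢ a :≤ a :+ b) (1 ∷ []) refl (d-nonNeg (X ‼ flip j) (Z ‼ flip j))

  -- Bounds the matching distance of unordered pairs; the matching that attains it may change from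
  -- request to request.
  Near : Pair → Pair → ℝ → Set
  Near X Z e = ∃[ i ] ∃[ j ] gap X Z i j ≤ e

  near-mono : ∀ {X Z a b} → a ≤ b → Near X Z a → Near X Z b
  near-mono a≤b (i , j , p) = i , j , ≤-trans p a≤b

  gap-sym : ∀ X Z i j → gap X Z i j ≡ gap Z X j i
  gap-sym X Z i j = cong₂ _+_ (d-sym (X ‼ i) (Z ‼ j)) (d-sym (X ‼ flip i) (Z ‼ flip j))

  near-sym : ∀ {X Z e} → Near X Z e → Near Z X e
  near-sym {X} {Z} (i , j , p) = j , i , ≤-trans (≤-reflexive (gap-sym Z X j i)) p

  near-at : ∀ {X Z e} → Near X Z e → ∀ i → ∃[ j ] gap X Z i j ≤ e
  near-at {X} {Z} (i , j , p) k with same-or-flip i k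
  ... | inj₁ refl = j , p
  ... | inj₂ refl = flip j , ≤-trans (≤-reflexive (gap-flip X Z i j)) p

  near-refl : ∀ X → Near X X 0#
  near-refl X = left , left ,
    linear 2 (λ a b → a :≤ :0 ⇒ b :≤ :0 ⇒ ⊢ a :+ b :≤ :0) (1 ∷ 1 ∷ []) refl
      (d-self (X ‼ left)) (d-self (X ‼ right))

  near-trans : ∀ {X Y Z a b} → Near X Y a → Near Y Z b → Near X Z (a + b)
  near-trans {X} {Y} {Z} (i , j , p) YZ with near-at YZ j
  ... | k , q = i , k ,
    linear 8 (λ xz xy yz xz' xy' yz' a b → xz :≤ xy :+ yz ⇒ xz' :≤ xy' :+ yz' ⇒ xy :+ xy' :≤ a ⇒
      yz :+ yz' :≤ b ⇒ ⊢ xz :+ xz' :≤ a :+ b) (1 ∷ 1 ∷ 1 ∷ 1 ∷ []) refl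
      (triangle (X ‼ i) (Y ‼ j) (Z ‼ k)) (triangle (X ‼ flip i) (Y ‼ flip j) (Z ‼ flip k)) p q

  -- One taxi waits at p, the destination of the previous request, and X holds the other two.
  -- If slot i serves the request, the taxi from p takes over its slot.
  data Step (p r : ℝ) (X X′ : Pair) (c : ℝ) : Set where
    keep : d p r + gap X X′ left left ≤ c → Step p r X X′ c
    use  : ∀ i → d (X ‼ i) r + (d p (X′ ‼ i) + d (X ‼ flip i) (X′ ‼ flip i)) ≤ c → Step p r X X′ c

  keep-gap : ∀ {p r X X′ c} → d p r + gap X X′ left left ≤ c → ∀ i → d p r + gap X X′ i i ≤ c
  keep-gap {X = X} {X′} h i rewrite gap-diagonal X X′ i = h

  step-nonNeg : ∀ {p r X X′ c} → Step p r X X′ c → 0# ≤ c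
  step-nonNeg (keep h)  = ≤-trans (+-nonNeg (d-nonNeg _ _) (+-nonNeg (d-nonNeg _ _) (d-nonNeg _ _))) h
  step-nonNeg (use i h) = ≤-trans (+-nonNeg (d-nonNeg _ _) (+-nonNeg (d-nonNeg _ _) (d-nonNeg _ _))) h

  private
    -- The new slots i and j are connected back to X, over to Z, with the server of Z to r, along
    -- the way between r and p that X has paid, and on from p to the new slot of Z.
    keep-use : ∀ {p r X X′ Z Z′ c c′ e} i j →
      d p r + gap X X′ i i ≤ c → d (Z ‼ j) r + (d p (Z′ ‼ j) + d (Z ‼ flip j) (Z′ ‼ flip j)) ≤ c′ →
      gap X Z i j ≤ e → gap X′ Z′ i j ≤ e + (c + c′)
    keep-use {p} {r} {X} {X′} {Z} {Z′} i j h k g =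
      linear 16 (λ xz' xx xz zr rp pz' D yw' yy yw ww c c' e xx' yy' →
        xz' :≤ xx' :+ xz :+ zr :+ rp :+ pz' ⇒ xx' :≤ xx ⇒ rp :≤ D ⇒ yw' :≤ yy' :+ yw :+ ww ⇒
        yy' :≤ yy ⇒ D :+ (xx :+ yy) :≤ c ⇒ zr :+ (pz' :+ ww) :≤ c' ⇒ xz :+ yw :≤ e ⇒
        ⊢ xz' :+ yw' :≤ e :+ (c :+ c')) (1 ∷ 1 ∷ 1 ∷ 1 ∷ 1 ∷ 1 ∷ 1 ∷ 1 ∷ []) refl
        (triangle₅ (X′ ‼ i) (X ‼ i) (Z ‼ j) r p (Z′ ‼ j)) (d-swap _ _) (d-swap r p)
        (triangle₃ (X′ ‼ flip i) (X ‼ flip i) (Z ‼ flip j) (Z′ ‼ flip j)) (d-swap _ _)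
        h k g

  -- If both serve from p, the matching persists; if one does, `keep-use` applies to the serving
  -- slot and its partner. If both serve from slots, these are both refilled from p and become
  -- partners.
  step-near : ∀ {p r X X′ Z Z′ c c′ e} →
    Step p r X X′ c → Step p r Z Z′ c′ → Near X Z e → Near X′ Z′ (e + (c + c′))
  step-near {p} {r} {X} {X′} {Z} {Z′} (keep h) (keep k) (i , j , g) = i , j ,
    linear 14 (λ xz' xx' xx xz zz yw' yy' yy yw ww c c' e D → xz' :≤ xx' :+ xz :+ zz ⇒
      xx' :≤ xx ⇒ yw' :≤ yy' :+ yw :+ ww ⇒ yy' :≤ yy ⇒ :0 :≤ D ⇒ D :+ (xx :+ yy) :≤ c ⇒
      D :+ (zz :+ ww) :≤ c' ⇒ xz :+ yw :≤ e ⇒ ⊢ xz' :+ yw' :≤ e :+ (c :+ c'))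
      (1 ∷ 1 ∷ 1 ∷ 1 ∷ 2 ∷ 1 ∷ 1 ∷ 1 ∷ []) refl
      (triangle₃ (X′ ‼ i) (X ‼ i) (Z ‼ j) (Z′ ‼ j)) (d-swap _ _)
      (triangle₃ (X′ ‼ flip i) (X ‼ flip i) (Z ‼ flip j) (Z′ ‼ flip j)) (d-swap _ _)
      (d-nonNeg p r) (keep-gap h i) (keep-gap k j) g
  step-near {X = X} {Z = Z} (keep h) (use j k) XZ with near-at (near-sym XZ) j
  ... | i , g = i , j , keep-use i j (keep-gap h i) k (≤-trans (≤-reflexive (gap-sym X Z i j)) g)
  step-near {X = X} {Z = Z} {c = c} {c′} {e} (use i h) (keep k) XZ with near-at XZ i
  ... | j , g = near-mono (linear 3 (λ c c' e → ⊢ e :+ (c' :+ c) :≤ e :+ (c :+ c')) [] refl) (near-sym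
    (j , i , keep-use j i (keep-gap k j) h (≤-trans (≤-reflexive (gap-sym Z X j i)) g)))
  step-near {p} {r} {X} {X′} {Z} {Z′} (use i h) (use j k) XZ with near-at XZ i
  ... | m , g with same-or-flip j m
  ...   | inj₁ refl = i , j ,
    linear 15 (λ xz' xp' xp pz yw' yy' yy yw ww c c' e xr zr xz → xz' :≤ xp' :+ pz ⇒ xp' :≤ xp ⇒
      yw' :≤ yy' :+ yw :+ ww ⇒ yy' :≤ yy ⇒ :0 :≤ xr ⇒ :0 :≤ zr ⇒ :0 :≤ xz ⇒
      xr :+ (xp :+ yy) :≤ c ⇒ zr :+ (pz :+ ww) :≤ c' ⇒ xz :+ yw :≤ e ⇒
      ⊢ xz' :+ yw' :≤ e :+ (c :+ c')) (1 ∷ 1 ∷ 1 ∷ 1 ∷ 1 ∷ 1 ∷ 1 ∷ 1 ∷ 1 ∷ 1 ∷ []) refl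
      (triangle (X′ ‼ i) p (Z′ ‼ j)) (d-swap _ _)
      (triangle₃ (X′ ‼ flip i) (X ‼ flip i) (Z ‼ flip j) (Z′ ‼ flip j)) (d-swap _ _)
      (d-nonNeg _ _) (d-nonNeg _ _) (d-nonNeg _ _) h k g
  -- The servers were not partners: the remaining slots are connected through the old partner of
  -- each, which is the server of the other strategy, and through r, where both servers meet.
  ...   | inj₂ refl = i , j ,
    linear 16 (λ xz' xp' xp pz yw' yy' yy yz xw ww c c' e xr rx zr → xz' :≤ xp' :+ pz ⇒
      xp' :≤ xp ⇒ yw' :≤ yy' :+ yz :+ zr :+ rx :+ (xw :+ ww) ⇒ yy' :≤ yy ⇒ rx :≤ xr ⇒
      xr :+ (xp :+ yy) :≤ c ⇒ zr :+ (pz :+ ww) :≤ c' ⇒ xw :+ yz :≤ e ⇒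
      ⊢ xz' :+ yw' :≤ e :+ (c :+ c')) (1 ∷ 1 ∷ 1 ∷ 1 ∷ 1 ∷ 1 ∷ 1 ∷ 1 ∷ []) refl
      (triangle (X′ ‼ i) p (Z′ ‼ j)) (d-swap _ _)
      (≤-trans (triangle₅ (X′ ‼ flip i) (X ‼ flip i) (Z ‼ j) r (X ‼ i) (Z′ ‼ flip j))
        (+-mono-≤ ≤-refl (triangle (X ‼ i) (Z ‼ flip j) (Z′ ‼ flip j))))
      (d-swap _ _) (d-swap r (X ‼ i)) h k
      (subst (λ m → d (X ‼ i) (Z ‼ flip j) + d (X ‼ flip i) (Z ‼ m) ≤ _) (flip-involutive j) g)

  -- Paths of strategies and the pursuit by one slot.

  Request′ : Set
  Request′ = ℝ × ℝ

  -- Requests since a root position are listed with the latest first.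
  position : ℝ → List Request′ → ℝ
  position p []            = p
  position p ((s , t) ∷ τ) = t

  data Path (p : ℝ) (X₀ : Pair) : List Request′ → Pair → ℝ → Set where
    []  : Path p X₀ [] X₀ 0#
    _∷_ : ∀ {s t τ X X′ κ c} → Step (position p τ) s X X′ c → Path p X₀ τ X κ →
          Path p X₀ ((s , t) ∷ τ) X′ (κ + c)

  path-nonNeg : ∀ {p X₀ τ X κ} → Path p X₀ τ X κ → 0# ≤ κ
  path-nonNeg []       = ≤-refl
  path-nonNeg (m ∷ ms) = +-nonNeg (path-nonNeg ms) (step-nonNeg m)

  path-near : ∀ {p X₀ Z₀ τ X Z κ κ′ e} →
    Path p X₀ τ X κ → Path p Z₀ τ Z κ′ → Near X₀ Z₀ e → Near X Z (e + (κ + κ′))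
  path-near []       []       XZ = near-mono (linear 1 (λ e → ⊢ e :≤ e :+ (:0 :+ :0)) [] refl) XZ
  path-near (m ∷ ms) (n ∷ ns) XZ = near-mono
    (linear 5 (λ e a b c c' → ⊢ e :+ (a :+ b) :+ (c :+ c') :≤ e :+ ((a :+ c) :+ (b :+ c')))
      [] refl)
    (step-near m n (path-near ms ns XZ))

  -- `cheap` and `close` are for requests at which an offline strategy serves from p and so pays
  -- `d p r`. `approaches` is for those served by the pursued slot: it goes to r and is refilled
  -- from p, so that three times the distance to it is a potential that pays the price.
  record Chase (p r : ℝ) (i : Side) (Z : Pair) : Set where
    field
      target     : Pair
      price      : ℝ
      step       : Step p r Z target price
      cheap      : price ≤ 3 ⋆ d p r
      close      : d (Z ‼ i) (target ‼ i) ≤ 3 ⋆ d p r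
      approaches : price + 3 ⋆ d (target ‼ i) p ≤ 3 ⋆ d (Z ‼ i) r

  open Chase

  -- Slot i serves the request if the taxi at p is not much closer; otherwise the taxi at p serves
  -- and slot i advances by twice the distance from p.
  chase : ∀ p r i Z → Chase p r i Z
  chase p r i Z with total (d (Z ‼ i) r) (2 ⋆ d p r)
  ... | inj₁ near = record
    { target     = Z [ i ≔ p ]
    ; price      = d (Z ‼ i) r
    ; step       = use i (subst₂ (λ u v → d (Z ‼ i) r + (d p u + d (Z ‼ flip i) v) ≤ d (Z ‼ i) r)
        (sym (‼-update Z i p)) (sym (‼-update-flip Z i p))
        (linear 3 (λ a b c → b :≤ :0 ⇒ c :≤ :0 ⇒ ⊢ a :+ (b :+ c) :≤ a) (1 ∷ 1 ∷ []) refl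
          (d-self p) (d-self (Z ‼ flip i))))
    ; cheap      = linear 2 (λ y D → y :≤ 2 :⋆ D ⇒ :0 :≤ D ⇒ ⊢ y :≤ 3 :⋆ D) (1 ∷ 1 ∷ []) refl
      near (d-nonNeg p r)
    ; close      = subst (λ u → d (Z ‼ i) u ≤ 3 ⋆ d p r) (sym (‼-update Z i p))
        (linear 4 (λ x y D E → x :≤ y :+ E ⇒ E :≤ D ⇒ y :≤ 2 :⋆ D ⇒ ⊢ x :≤ 3 :⋆ D)
          (1 ∷ 1 ∷ 1 ∷ []) refl
          (triangle (Z ‼ i) r p) (d-swap r p) near)
    ; approaches = subst (λ u → d (Z ‼ i) r + 3 ⋆ d u p ≤ 3 ⋆ d (Z ‼ i) r) (sym (‼-update Z i p))
        (linear 2 (λ y b → b :≤ :0 ⇒ :0 :≤ y ⇒ ⊢ y :+ 3 :⋆ b :≤ 3 :⋆ y) (3 ∷ 2 ∷ []) refl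
          (d-self p) (d-nonNeg (Z ‼ i) r))
    }
  ... | inj₂ far
    with y , moved , rest ← towards (Z ‼ i) r
      (linear 1 (λ D → :0 :≤ D ⇒ ⊢ :0 :≤ 2 :⋆ D) (2 ∷ []) refl (d-nonNeg p r)) far = record
    { target     = Z [ i ≔ y ]
    ; price      = 3 ⋆ d p r
    ; step       = keep (subst (λ g → d p r + g ≤ 3 ⋆ d p r) (gap-diagonal Z (Z [ i ≔ y ]) i)
        (subst₂ (λ u v → d p r + (d (Z ‼ i) u + d (Z ‼ flip i) v) ≤ 3 ⋆ d p r)
          (sym (‼-update Z i y)) (sym (‼-update-flip Z i y))
          (linear 3 (λ D m b → m :≤ 2 :⋆ D ⇒ b :≤ :0 ⇒ ⊢ D :+ (m :+ b) :≤ 3 :⋆ D)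
            (1 ∷ 1 ∷ []) refl moved (d-self (Z ‼ flip i)))))
    ; cheap      = ≤-refl
    ; close      = subst (λ u → d (Z ‼ i) u ≤ 3 ⋆ d p r) (sym (‼-update Z i y))
        (linear 2 (λ D m → m :≤ 2 :⋆ D ⇒ :0 :≤ D ⇒ ⊢ m :≤ 3 :⋆ D) (1 ∷ 1 ∷ []) refl
          moved (d-nonNeg p r))
    -- The distance to r falls by `2 ⋆ d p r`. Going on from r to p takes half of this gain, and
    -- three times the other half is the price.
    ; approaches = subst (λ u → 3 ⋆ d p r + 3 ⋆ d u p ≤ 3 ⋆ d (Z ‼ i) r) (sym (‼-update Z i y))
        (linear 5 (λ D E x yr f → yr :≤ x :+ E ⇒ E :≤ D ⇒ x :+ 2 :⋆ D :≤ f ⇒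
          ⊢ 3 :⋆ D :+ 3 :⋆ yr :≤ 3 :⋆ f) (3 ∷ 3 ∷ 3 ∷ []) refl
          (triangle y r p) (d-swap r p) rest)
    }

  -- A step after a change of plan: at a change of the lead or the end of a stage, the taxis first
  -- go to `middle`.
  record Move (p r : ℝ) (X X′ : Pair) (c : ℝ) : Set where
    field
      {middle}         : Pair
      {before during}  : ℝ
      near             : Near X middle before
      step             : Step p r middle X′ during
      total            : before + during ≤ c

  -- The other slot stays where it is.
  pursuit : ∀ p Y (i : Side) τ → ∃[ Z ] ∃[ c ] Path p Y τ Z c
  pursuit p Y i []            = Y , 0# , []
  pursuit p Y i ((s , t) ∷ τ) =
    let Z , c , path = pursuit p Y i τ
        m            = chase (position p τ) s i Z
    in target m , c + price m , step m ∷ path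

  -- S bounds the joint cost of X and Z at one request. If one of them serves from p, its `d p r`
  -- also pays for the way from r to p by which a slot of the other is displaced when it serves and
  -- is refilled; hence slots keep their identity up to S.
  data Joint (p r : ℝ) (X X₁ Z Z₁ : Pair) (S : ℝ) : Set where
    alone    : d p r ≤ S → (∀ i j → d (X ‼ i) (X₁ ‼ i) + d (Z ‼ j) (Z₁ ‼ j) ≤ S) →
               Joint p r X X₁ Z Z₁ S
    together : ∀ i j →
               d (X ‼ i) r + (d p (X₁ ‼ i) + d (X ‼ flip i) (X₁ ‼ flip i)) +
               (d (Z ‼ j) r + (d p (Z₁ ‼ j) + d (Z ‼ flip j) (Z₁ ‼ flip j))) ≤ S →
               Joint p r X X₁ Z Z₁ S

  private
    displacement-use : ∀ {p r X X′ c} i j →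
      d (X ‼ i) r + (d p (X′ ‼ i) + d (X ‼ flip i) (X′ ‼ flip i)) ≤ c →
      d (X ‼ j) (X′ ‼ j) ≤ c + d p r
    displacement-use {p} {r} {X} {X′} i j h with same-or-flip i j
    ... | inj₁ refl =
      linear 7 (λ xx xr rp px D o c → xx :≤ xr :+ rp :+ px ⇒ rp :≤ D ⇒ :0 :≤ o ⇒
        xr :+ (px :+ o) :≤ c ⇒ ⊢ xx :≤ c :+ D) (1 ∷ 1 ∷ 1 ∷ 1 ∷ []) refl
        (triangle₃ (X ‼ i) r p (X′ ‼ i)) (d-swap r p)
        (d-nonNeg (X ‼ flip i) (X′ ‼ flip i)) h
    ... | inj₂ refl =
      linear 5 (λ xr px D o c → :0 :≤ xr ⇒ :0 :≤ px ⇒ :0 :≤ D ⇒ xr :+ (px :+ o) :≤ c ⇒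
        ⊢ o :≤ c :+ D) (1 ∷ 1 ∷ 1 ∷ 1 ∷ []) refl
        (d-nonNeg (X ‼ i) r) (d-nonNeg p (X′ ‼ i)) (d-nonNeg p r) h

    displacement-keep : ∀ {p r X X′ c} j → d p r + gap X X′ left left ≤ c →
      d p r + d (X ‼ j) (X′ ‼ j) ≤ c
    displacement-keep {X = X} {X′} j h =
      linear 4 (λ D g x c → D :+ g :≤ c ⇒ x :≤ g ⇒ ⊢ D :+ x :≤ c) (1 ∷ 1 ∷ []) refl
        h (gap-component X X′ left j)

  joint : ∀ {p r X X₁ Z Z₁ s s′} → Step p r X X₁ s → Step p r Z Z₁ s′ → Joint p r X X₁ Z Z₁ (s + s′)
  joint {p} {r} m@(keep h) n@(keep k) = alone
    (linear 4 (λ D g s s' → D :+ g :≤ s ⇒ :0 :≤ g ⇒ :0 :≤ s' ⇒ ⊢ D :≤ s :+ s')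
      (1 ∷ 1 ∷ 1 ∷ []) refl
      h (gap-nonNeg _ _ left left) (step-nonNeg n))
    (λ i j → linear 5 (λ D x z s s' → D :+ x :≤ s ⇒ D :+ z :≤ s' ⇒ :0 :≤ D ⇒ ⊢ x :+ z :≤ s :+ s')
      (1 ∷ 1 ∷ 2 ∷ []) refl
      (displacement-keep i h) (displacement-keep j k) (d-nonNeg p r))
  joint {p} {r} m@(keep h) n@(use i k) = alone
    (linear 4 (λ D g s s' → D :+ g :≤ s ⇒ :0 :≤ g ⇒ :0 :≤ s' ⇒ ⊢ D :≤ s :+ s')
      (1 ∷ 1 ∷ 1 ∷ []) refl
      h (gap-nonNeg _ _ left left) (step-nonNeg n))
    (λ j l → linear 5 (λ D x z s s' → D :+ x :≤ s ⇒ z :≤ s' :+ D ⇒ ⊢ x :+ z :≤ s :+ s')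
      (1 ∷ 1 ∷ []) refl
      (displacement-keep j h) (displacement-use i l k))
  joint {p} {r} m@(use i h) n@(keep k) = alone
    (linear 4 (λ D g s s' → D :+ g :≤ s' ⇒ :0 :≤ g ⇒ :0 :≤ s ⇒ ⊢ D :≤ s :+ s')
      (1 ∷ 1 ∷ 1 ∷ []) refl
      k (gap-nonNeg _ _ left left) (step-nonNeg m))
    (λ j l → linear 5 (λ D x z s s' → D :+ z :≤ s' ⇒ x :≤ s :+ D ⇒ ⊢ x :+ z :≤ s :+ s')
      (1 ∷ 1 ∷ []) refl
      (displacement-keep l k) (displacement-use i j h))
  joint (use i h) (use j k) = together i j (+-mono-≤ h k)

  -- Two offline strategies against the two pursuits.

  module Pursuit (p : ℝ) (Y : Pair) where

    taxis : Side → List Request′ → Pair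
    taxis i τ = proj₁ (pursuit p Y i τ)

    spent : Side → List Request′ → ℝ
    spent i τ = proj₁ (proj₂ (pursuit p Y i τ))

    pursuit-path : ∀ i τ → Path p Y τ (taxis i τ) (spent i τ)
    pursuit-path i τ = proj₂ (proj₂ (pursuit p Y i τ))

    -- K is the total cost of the offline strategies now at X and Z, and e bounds the distance of the
    -- start of X from Y. Slots X ‼ i and Z ‼ j have last served the same request; when this happens
    -- with another pair of slots, that pair shares a slot with the last one, unless X and Z are near
    -- each other, and the pursuing slot k does not change.
    data Status (e K : ℝ) (τ : List Request′) (X Z : Pair) : Set where
      uncoupled : (∀ i → spent i τ + 3 ⋆ d (taxis i τ ‼ i) (X ‼ i) ≤ 3 ⋆ e + 15 ⋆ K) →
                  Status e K τ X Z
      coupled   : ∀ k i j → spent k τ + 3 ⋆ d (taxis k τ ‼ k) (X ‼ i) ≤ 3 ⋆ e + 15 ⋆ K →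
                  spent k τ + 3 ⋆ d (taxis k τ ‼ k) (Z ‼ j) ≤ 3 ⋆ e + 15 ⋆ K →
                  d (X ‼ i) (Z ‼ j) ≤ K → Status e K τ X Z
      merged    : Near X Z (2 ⋆ K) → Status e K τ X Z

    private
      module Advance (s t : ℝ) (τ : List Request′) {e K S K′ : ℝ} (K+S≤K′ : K + S ≤ K′) where
        pos = position p τ
        τ′  = (s , t) ∷ τ

        move : ∀ k → Chase pos s k (taxis k τ)
        move k = chase pos s k (taxis k τ)

        -- Either strategy may have brought slot k close to s; y is the taxi from pos afterwards.
        serving : ∀ k x y → spent k τ + 3 ⋆ d (taxis k τ ‼ k) x ≤ 3 ⋆ e + 15 ⋆ K →
          d x s + d pos y ≤ 2 ⋆ S → 0# ≤ S →
          spent k τ′ + 3 ⋆ d (taxis k τ′ ‼ k) y ≤ 3 ⋆ e + 15 ⋆ K′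
        serving k x y h u 0≤S =
          linear 12 (λ c q zx zs xs py z'p z'y e K S K' → c :+ 3 :⋆ zx :≤ 3 :⋆ e :+ 15 :⋆ K ⇒
            q :+ 3 :⋆ z'p :≤ 3 :⋆ zs ⇒ zs :≤ zx :+ xs ⇒ z'y :≤ z'p :+ py ⇒ xs :+ py :≤ 2 :⋆ S ⇒
            K :+ S :≤ K' ⇒ :0 :≤ S ⇒ ⊢ c :+ q :+ 3 :⋆ z'y :≤ 3 :⋆ e :+ 15 :⋆ K')
            (1 ∷ 1 ∷ 3 ∷ 3 ∷ 3 ∷ 15 ∷ 9 ∷ []) refl
            h (approaches (move k)) (triangle (taxis k τ ‼ k) x s)
            (triangle (taxis k τ′ ‼ k) pos y) u K+S≤K′ 0≤S

        -- The 15 is due to this case: 3 for the price, 9 for the move of slot k by up to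
        -- `3 ⋆ d pos s`, and 3 for that of the offline slot.
        drifting : ∀ k x y → spent k τ + 3 ⋆ d (taxis k τ ‼ k) x ≤ 3 ⋆ e + 15 ⋆ K →
          d x y ≤ S → d pos s ≤ S → spent k τ′ + 3 ⋆ d (taxis k τ′ ‼ k) y ≤ 3 ⋆ e + 15 ⋆ K′
        drifting k x y h u v =
          linear 12 (λ c q zx zz z'z z'y xy D e K S K' → c :+ 3 :⋆ zx :≤ 3 :⋆ e :+ 15 :⋆ K ⇒
            q :≤ 3 :⋆ D ⇒ z'z :≤ zz ⇒ zz :≤ 3 :⋆ D ⇒ z'y :≤ z'z :+ zx :+ xy ⇒ xy :≤ S ⇒ D :≤ S ⇒
            K :+ S :≤ K' ⇒ ⊢ c :+ q :+ 3 :⋆ z'y :≤ 3 :⋆ e :+ 15 :⋆ K')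
            (1 ∷ 1 ∷ 3 ∷ 3 ∷ 3 ∷ 3 ∷ 12 ∷ 15 ∷ []) refl
            h (cheap (move k)) (d-swap _ _) (close (move k))
            (triangle₃ (taxis k τ′ ‼ k) (taxis k τ ‼ k) x y) u v K+S≤K′

    -- Induction on the common requests. Only X has to start near Y: Z enters when both first serve
    -- from slots, as these meet at the request.
    status : ∀ {X₀ Z₀ τ X Z κ κ′ e} → (∀ i → d (Y ‼ i) (X₀ ‼ i) ≤ e) →
      Path p X₀ τ X κ → Path p Z₀ τ Z κ′ → Status e (κ + κ′) τ X Z
    status {e = e} Y≈X₀ [] [] = uncoupled λ i →
      linear 2 (λ y e → y :≤ e ⇒ ⊢ :0 :+ 3 :⋆ y :≤ 3 :⋆ e :+ 15 :⋆ (:0 :+ :0)) (3 ∷ []) refl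
        (Y≈X₀ i)
    status {e = e} Y≈X₀ (_∷_ {s} {t} {τ} {X} {X₁} {κ} {c} m ms) (_∷_ {X = Z} {Z₁} {κ′} {c′} n ns) =
      next (status Y≈X₀ ms ns) (joint m n)
      where
      K′ = (κ + c) + (κ′ + c′)
      0≤c = step-nonNeg m
      0≤c′ = step-nonNeg n
      0≤S : 0# ≤ c + c′
      0≤S = +-nonNeg 0≤c 0≤c′
      total-cost : (κ + κ′) + (c + c′) ≤ K′
      total-cost = linear 4 (λ k k' c c' → ⊢ (k :+ k') :+ (c :+ c') :≤ (k :+ c) :+ (k' :+ c'))
        [] refl
      open Advance s t τ {e} total-cost
      module Serve (a b : Side)
        (u : d (X ‼ a) s + (d (position p τ) (X₁ ‼ a) + d (X ‼ flip a) (X₁ ‼ flip a)) +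
          (d (Z ‼ b) s + (d (position p τ) (Z₁ ‼ b) + d (Z ‼ flip b) (Z₁ ‼ flip b))) ≤ c + c′)
        where
        fromX : d (X ‼ a) s ≤ c + c′
        fromX = linear 7 (λ xs px xx zs pz zz S → xs :+ (px :+ xx) :+ (zs :+ (pz :+ zz)) :≤ S ⇒
          :0 :≤ px ⇒ :0 :≤ xx ⇒ :0 :≤ zs ⇒ :0 :≤ pz ⇒ :0 :≤ zz ⇒ ⊢ xs :≤ S)
          (1 ∷ 1 ∷ 1 ∷ 1 ∷ 1 ∷ 1 ∷ []) refl
          u (d-nonNeg _ _) (d-nonNeg _ _) (d-nonNeg _ _) (d-nonNeg _ _) (d-nonNeg _ _)
        fromZ : d (Z ‼ b) s ≤ c + c′
        fromZ = linear 7 (λ xs px xx zs pz zz S → xs :+ (px :+ xx) :+ (zs :+ (pz :+ zz)) :≤ S ⇒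
          :0 :≤ xs ⇒ :0 :≤ px ⇒ :0 :≤ xx ⇒ :0 :≤ pz ⇒ :0 :≤ zz ⇒ ⊢ zs :≤ S)
          (1 ∷ 1 ∷ 1 ∷ 1 ∷ 1 ∷ 1 ∷ []) refl
          u (d-nonNeg _ _) (d-nonNeg _ _) (d-nonNeg _ _) (d-nonNeg _ _) (d-nonNeg _ _)
        toBoth : d (position p τ) (X₁ ‼ a) + d (position p τ) (Z₁ ‼ b) ≤ c + c′
        toBoth = linear 7 (λ xs px xx zs pz zz S → xs :+ (px :+ xx) :+ (zs :+ (pz :+ zz)) :≤ S ⇒
          :0 :≤ xs ⇒ :0 :≤ xx ⇒ :0 :≤ zs ⇒ :0 :≤ zz ⇒ ⊢ px :+ pz :≤ S)
          (1 ∷ 1 ∷ 1 ∷ 1 ∷ 1 ∷ []) refl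
          u (d-nonNeg _ _) (d-nonNeg _ _) (d-nonNeg _ _) (d-nonNeg _ _)
        couple : ∀ k x → spent k τ + 3 ⋆ d (taxis k τ ‼ k) x ≤ 3 ⋆ e + 15 ⋆ (κ + κ′) →
          d x s ≤ c + c′ → Status e K′ τ′ X₁ Z₁
        couple k x h v = coupled k a b
          (serving k x _ h (linear 4 (λ x px pz S → x :≤ S ⇒ px :+ pz :≤ S ⇒ :0 :≤ pz ⇒
            ⊢ x :+ px :≤ 2 :⋆ S) (1 ∷ 1 ∷ 1 ∷ []) refl
            v toBoth (d-nonNeg _ _)) 0≤S)
          (serving k x _ h (linear 4 (λ x px pz S → x :≤ S ⇒ px :+ pz :≤ S ⇒ :0 :≤ px ⇒
            ⊢ x :+ pz :≤ 2 :⋆ S) (1 ∷ 1 ∷ 1 ∷ []) refl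
            v toBoth (d-nonNeg _ _)) 0≤S)
          (linear 8 (λ xz xp px pz k k' S K' → xz :≤ xp :+ pz ⇒ xp :≤ px ⇒ px :+ pz :≤ S ⇒
            :0 :≤ k ⇒ :0 :≤ k' ⇒ (k :+ k') :+ S :≤ K' ⇒ ⊢ xz :≤ K')
            (1 ∷ 1 ∷ 1 ∷ 1 ∷ 1 ∷ 1 ∷ []) refl
            (triangle (X₁ ‼ a) (position p τ) (Z₁ ‼ b)) (d-swap _ _) toBoth
            (path-nonNeg ms) (path-nonNeg ns) total-cost)
      next : Status e (κ + κ′) τ X Z → Joint (position p τ) s X X₁ Z Z₁ (c + c′) →
             Status e K′ τ′ X₁ Z₁
      next (merged XZ) _ = merged (near-mono
        (linear 4 (λ k k' c c' → :0 :≤ c ⇒ :0 :≤ c' ⇒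
          ⊢ 2 :⋆ (k :+ k') :+ (c :+ c') :≤ 2 :⋆ ((k :+ c) :+ (k' :+ c'))) (1 ∷ 1 ∷ []) refl
          0≤c 0≤c′)
        (step-near m n XZ))
      next (uncoupled h) (alone D moved) = uncoupled λ i → drifting i _ _ (h i)
        (linear 3 (λ x z S → x :+ z :≤ S ⇒ :0 :≤ z ⇒ ⊢ x :≤ S) (1 ∷ 1 ∷ []) refl
          (moved i i) (d-nonNeg _ _)) D
      next (coupled k i j hX hZ XZ) (alone D moved) = coupled k i j
        (drifting k _ _ hX (linear 3 (λ x z S → x :+ z :≤ S ⇒ :0 :≤ z ⇒ ⊢ x :≤ S)
          (1 ∷ 1 ∷ []) refl (moved i j) (d-nonNeg _ _)) D)
        (drifting k _ _ hZ (linear 3 (λ x z S → x :+ z :≤ S ⇒ :0 :≤ x ⇒ ⊢ z :≤ S)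
          (1 ∷ 1 ∷ []) refl (moved i j) (d-nonNeg _ _)) D)
        (linear 8 (λ xz' xx' xx xz zz K S K' → xz' :≤ xx' :+ xz :+ zz ⇒ xx' :≤ xx ⇒
          xx :+ zz :≤ S ⇒ xz :≤ K ⇒ K :+ S :≤ K' ⇒ ⊢ xz' :≤ K') (1 ∷ 1 ∷ 1 ∷ 1 ∷ 1 ∷ []) refl
          (triangle₃ (X₁ ‼ i) (X ‼ i) (Z ‼ j) (Z₁ ‼ j)) (d-swap _ _) (moved i j) XZ total-cost)
      -- Both pursuits qualify up to here; the slot by which X serves selects one.
      next (uncoupled h) (together a b u) = couple a (X ‼ a) (h a) fromX
        where open Serve a b u
      next (coupled k i j hX hZ XZ) (together a b u) with same-or-flip a i
      ... | inj₁ refl = couple k (X ‼ a) hX fromX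
        where open Serve a b u
      -- X serves by its uncoupled slot. If Z serves by the coupled one, slot k has followed that as
      -- well and goes on from there.
      ... | inj₂ refl with same-or-flip b j
      ...   | inj₁ refl = couple k (Z ‼ b) hZ fromZ
        where open Serve a b u
      -- Neither server is coupled: the coupled slots are within K of each other, and those that
      -- serve now are both refilled from p.
      ...   | inj₂ refl = merged (a , b ,
        linear 14 (λ xz xp px pz yw yy' yy w ww xs zs K S K' → xz :≤ xp :+ pz ⇒ xp :≤ px ⇒
          yw :≤ yy' :+ w :+ ww ⇒ yy' :≤ yy ⇒ w :≤ K ⇒
          xs :+ (px :+ yy) :+ (zs :+ (pz :+ ww)) :≤ S ⇒ K :+ S :≤ K' ⇒ :0 :≤ xs ⇒ :0 :≤ zs ⇒
          :0 :≤ w ⇒ :0 :≤ S ⇒ ⊢ xz :+ yw :≤ 2 :⋆ K')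
          (1 ∷ 1 ∷ 1 ∷ 1 ∷ 2 ∷ 1 ∷ 2 ∷ 1 ∷ 1 ∷ 1 ∷ 1 ∷ []) refl
          (triangle (X₁ ‼ a) (position p τ) (Z₁ ‼ b)) (d-swap _ _)
          (triangle₃ (X₁ ‼ flip a) (X ‼ flip a) (Z ‼ flip b) (Z₁ ‼ flip b)) (d-swap _ _) XZ u
          total-cost (d-nonNeg _ _) (d-nonNeg _ _) (d-nonNeg _ _) 0≤S)

    pursuit-or-near : ∀ {X₀ Z₀ τ X Z κ κ′ e} → (∀ i → d (Y ‼ i) (X₀ ‼ i) ≤ e) →
      Path p X₀ τ X κ → Path p Z₀ τ Z κ′ →
      (∃[ k ] spent k τ ≤ 3 ⋆ e + 15 ⋆ (κ + κ′)) ⊎ Near X Z (2 ⋆ (κ + κ′))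
    pursuit-or-near Y≈X₀ ms ns with status Y≈X₀ ms ns
    ... | uncoupled h         = inj₁ (left ,
      linear 3 (λ c x B → c :+ 3 :⋆ x :≤ B ⇒ :0 :≤ x ⇒ ⊢ c :≤ B) (1 ∷ 3 ∷ []) refl
        (h left) (d-nonNeg _ _))
    ... | coupled k _ _ h _ _ = inj₁ (k ,
      linear 3 (λ c x B → c :+ 3 :⋆ x :≤ B ⇒ :0 :≤ x ⇒ ⊢ c :≤ B) (1 ∷ 3 ∷ []) refl h (d-nonNeg _ _))
    ... | merged XZ           = inj₂ XZ

    -- Following the cheaper pursuit.

    leader : List Request′ → Side
    leader []      = left
    leader (q ∷ τ) with total (spent (leader τ) (q ∷ τ)) (2 ⋆ spent (flip (leader τ)) (q ∷ τ))
    ... | inj₁ _ = leader τ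
    ... | inj₂ _ = flip (leader τ)

    leading : List Request′ → Pair
    leading τ = taxis (leader τ) τ

    -- T is what following the leader has cost so far, and h what the leader had spent when it took
    -- the lead. Between changes of the lead h doubles, so that T is dominated by the last term.
    record Balanced (s : Side) (τ : List Request′) (T : ℝ) : Set where
      field
        h        : ℝ
        h≤leader : h ≤ spent s τ
        h≤other  : 2 ⋆ h ≤ spent (flip s) τ
        T≤       : T ≤ 9 ⋆ h + spent s τ
        ahead    : spent s τ ≤ 2 ⋆ spent (flip s) τ

    spent-nonNeg : ∀ i τ → 0# ≤ spent i τ
    spent-nonNeg i τ = path-nonNeg (pursuit-path i τ)

    price-nonNeg : ∀ i s τ → 0# ≤ price (chase (position p τ) s i (taxis i τ))
    price-nonNeg i s τ = step-nonNeg (step (chase (position p τ) s i (taxis i τ)))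

    balanced-[] : Balanced left [] 0#
    balanced-[] = record
      { h = 0# ; h≤leader = ≤-refl ; h≤other = linear 0 (⊢ 2 :⋆ :0 :≤ :0) [] refl
      ; T≤ = linear 0 (⊢ :0 :≤ 9 :⋆ :0 :+ :0) [] refl ; ahead = linear 0 (⊢ :0 :≤ 2 :⋆ :0)
        [] refl }

    -- If the leader has spent c and the other side o, then 9 h + c is at most (9/2 + 2) o.
    balanced-cost : ∀ {s τ T} → Balanced s τ T → ∀ i → T ≤ 10 ⋆ spent i τ
    balanced-cost {s} {τ} b i with same-or-flip s i
    ... | inj₁ refl = linear 3 (λ h c T → h :≤ c ⇒ T :≤ 9 :⋆ h :+ c ⇒ ⊢ T :≤ 10 :⋆ c)
      (9 ∷ 1 ∷ []) refl
      (Balanced.h≤leader b) (Balanced.T≤ b)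
    ... | inj₂ refl =
      linear 4 (λ h c o T → 2 :⋆ h :≤ o ⇒ T :≤ 9 :⋆ h :+ c ⇒ c :≤ 2 :⋆ o ⇒ :0 :≤ o ⇒
        ⊢ T :≤ 10 :⋆ o) (9 ∷ 2 ∷ 2 ∷ 7 ∷ 1 ∷ []) refl
      (Balanced.h≤other b) (Balanced.T≤ b) (Balanced.ahead b) (spent-nonNeg (flip s) τ)

    balanced-leader : ∀ {s τ T} → Balanced s τ T → ∀ i → spent s τ ≤ 2 ⋆ spent i τ
    balanced-leader {s} {τ} b i with same-or-flip s i
    ... | inj₁ refl = linear 1 (λ c → :0 :≤ c ⇒ ⊢ c :≤ 2 :⋆ c) (1 ∷ []) refl (spent-nonNeg s τ)
    ... | inj₂ refl = Balanced.ahead b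

    follow : ∀ q τ → ∃[ c ] Move (position p τ) (proj₁ q) (leading τ) (leading (q ∷ τ)) c ×
      (∀ T → Balanced (leader τ) τ T → Balanced (leader (q ∷ τ)) (q ∷ τ) (T + c))
    follow (s , t) τ
      with total (spent (leader τ) ((s , t) ∷ τ)) (2 ⋆ spent (flip (leader τ)) ((s , t) ∷ τ))
    ... | inj₁ ahead′ = price m , record
      { near = near-refl _ ; step = step m ; total = linear 1 (λ c → ⊢ :0 :+ c :≤ c) [] refl } ,
      λ T b → let open Balanced b in record
        { h        = h
        ; h≤leader = linear 3 (λ h c q → h :≤ c ⇒ :0 :≤ q ⇒ ⊢ h :≤ c :+ q) (1 ∷ 1 ∷ []) refl
          h≤leader (price-nonNeg l s τ)
        ; h≤other  = linear 3 (λ h c q → 2 :⋆ h :≤ c ⇒ :0 :≤ q ⇒ ⊢ 2 :⋆ h :≤ c :+ q)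
          (1 ∷ 1 ∷ []) refl
            h≤other (price-nonNeg (flip l) s τ)
        ; T≤       = linear 4 (λ h c q T → T :≤ 9 :⋆ h :+ c ⇒ ⊢ T :+ q :≤ 9 :⋆ h :+ (c :+ q))
          (1 ∷ []) refl T≤
        ; ahead    = ahead′
        }
      where
      l = leader τ
      m = chase (position p τ) s l (taxis l τ)
    ... | inj₂ behind = spent l τ + spent o τ + price m , record
      -- Both pursuits start at Y, so that their taxis differ by at most what they have spent
      -- together.
      { near  = path-near (pursuit-path l τ) (pursuit-path o τ) (near-refl Y)
      ; step  = step m
      ; total = linear 3 (λ a b c → ⊢ :0 :+ (a :+ b) :+ c :≤ a :+ b :+ c) [] refl } ,
      λ T b → let open Balanced b in record
        { h        = spent o τ + price m
        ; h≤leader = ≤-refl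
        ; h≤other  = subst (λ i → 2 ⋆ (spent o τ + price m) ≤ spent i ((s , t) ∷ τ))
            (sym (flip-involutive l)) behind
        -- 9 h + 2 c + o + q is at most (9/2 + 4 + 1) o + q, which fits into ten times the new h.
        ; T≤       = linear 5 (λ h c q o T → T :≤ 9 :⋆ h :+ c ⇒ 2 :⋆ h :≤ o ⇒ c :≤ 2 :⋆ o ⇒
          :0 :≤ q ⇒ :0 :≤ o ⇒ ⊢ T :+ (c :+ o :+ q) :≤ 9 :⋆ (o :+ q) :+ (o :+ q))
          (2 ∷ 9 ∷ 4 ∷ 18 ∷ 1 ∷ 1 ∷ []) refl
            T≤ h≤other ahead (price-nonNeg o s τ) (spent-nonNeg o τ)
        ; ahead    = subst (λ i → spent o τ + price m ≤ 2 ⋆ spent i ((s , t) ∷ τ))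
            (sym (flip-involutive l))
            (linear 2 (λ a b → 2 :⋆ a :≤ b ⇒ :0 :≤ b ⇒ ⊢ a :≤ 2 :⋆ b) (1 ∷ 3 ∷ 1 ∷ []) refl
              behind (spent-nonNeg l ((s , t) ∷ τ)))
        }
      where
      l = leader τ
      o = flip l
      m = chase (position p τ) s o (taxis o τ)

-- Stages, their scale and their cost.

module Stages (R : Reals) where
  open Reals R
  open LinearArithmetic R
  open OrderedField R
  open Distance R
  open Game R

  -- A stage starts with the supposition that the offline taxis are within z of Y.
  record Root : Set where
    field
      p   : ℝ
      Y   : Pair
      z   : ℝ
      z≰0 : ¬ z ≤ 0#

  module Stage (ρ : Root) where
    open Root ρ
    open Pursuit p Y

    0≤z : 0# ≤ z
    0≤z with total 0# z
    ... | inj₁ 0≤z = 0≤z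
    ... | inj₂ z≤0 = ⊥-elim (z≰0 z≤0)

    -- The factor 32 keeps `15 ⋆ (κ + κ′)` in `pursuit-or-near` below v if the offline cost κ′ obeys
    -- the same bound as κ.
    record Admissible (τ : List Request′) (v : ℝ) : Set where
      field
        {X₀ X}     : Pair
        {κ}        : ℝ
        path       : Path p X₀ τ X κ
        start      : gap Y X₀ left left ≤ v
        affordable : 32 ⋆ κ ≤ v
        coarse     : z ≤ v

    admissible-nonNeg : ∀ {τ v} → Admissible τ v → 0# ≤ v
    admissible-nonNeg a = ≤-trans 0≤z (Admissible.coarse a)

    admissible-tail : ∀ {q τ v} → Admissible (q ∷ τ) v → Admissible τ v
    admissible-tail record { path = m ∷ ms ; start = h ; affordable = k ; coarse = l } = record
      { path = ms ; start = h
      ; affordable = linear 3 (λ a b v → 32 :⋆ (a :+ b) :≤ v ⇒ :0 :≤ b ⇒ ⊢ 32 :⋆ a :≤ v)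
        (1 ∷ 32 ∷ []) refl k (step-nonNeg m)
      ; coarse = l }

    -- The infimum need not be attained, hence the factor 2.
    NearlyLeast : List Request′ → ℝ → Set
    NearlyLeast τ v = Admissible τ v × (∀ u → Admissible τ u → v ≤ 2 ⋆ u)

    some-admissible : ∀ τ → Admissible τ (z + 32 ⋆ spent left τ)
    some-admissible τ = record
      { path       = pursuit-path left τ
      ; start      = linear 4 (λ a b z c → a :≤ :0 ⇒ b :≤ :0 ⇒ :0 :≤ z ⇒ :0 :≤ c ⇒
        ⊢ a :+ b :≤ z :+ 32 :⋆ c) (1 ∷ 1 ∷ 1 ∷ 32 ∷ []) refl
          (d-self (Y ‼ left)) (d-self (Y ‼ right)) 0≤z (spent-nonNeg left τ)
      ; affordable = linear 2 (λ z c → :0 :≤ z ⇒ ⊢ 32 :⋆ c :≤ z :+ 32 :⋆ c) (1 ∷ []) refl 0≤z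
      ; coarse     = linear 2 (λ z c → :0 :≤ c ⇒ ⊢ z :≤ z :+ 32 :⋆ c) (32 ∷ []) refl
        (spent-nonNeg left τ)
      }

    -- Otherwise twice the infimum s is a lower bound too, so that s ≤ 0, against z ≤ s.
    nearly-least : ExcludedMiddle 0ℓ → ∀ τ → ∃ (NearlyLeast τ)
    nearly-least em τ
      with infimum (Admissible τ) (_ , some-admissible τ) (z , λ _ → Admissible.coarse)
    ... | s , lower , greatest with em {∃[ v ] Admissible τ v × v ≤ 2 ⋆ s}
    ...   | yes (v , a , v≤2s) = v , a , λ u b →
      linear 3 (λ u v s → v :≤ 2 :⋆ s ⇒ s :≤ u ⇒ ⊢ v :≤ 2 :⋆ u) (1 ∷ 2 ∷ []) refl v≤2s (lower u b)
    ...   | no none = ⊥-elim (z≰0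
      (linear 2 (λ z s → z :≤ s ⇒ 2 :⋆ s :≤ s ⇒ ⊢ z :≤ :0) (1 ∷ 1 ∷ []) refl
        (greatest z (λ _ → Admissible.coarse)) (greatest (2 ⋆ s) above)))
      where
      above : LowerBound (Admissible τ) (2 ⋆ s)
      above v a with total (2 ⋆ s) v
      ... | inj₁ 2s≤v = 2s≤v
      ... | inj₂ v≤2s = ⊥-elim (none (v , a , v≤2s))

    Jump : List Request′ → Set
    Jump τ = ∃[ v ] NearlyLeast τ v × (∀ i → ¬ spent i τ ≤ 4 ⋆ v)

    Calm : List Request′ → Set
    Calm τ = ∀ u → Admissible τ u → ∃[ i ] spent i τ ≤ 8 ⋆ u

    calm-[] : Calm []
    calm-[] u a = left , linear 1 (λ u → :0 :≤ u ⇒ ⊢ :0 :≤ 8 :⋆ u) (8 ∷ []) refl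
      (admissible-nonNeg a)

    -- The 8 in `Calm` is the 4 in `Jump` times the 2 in `NearlyLeast`.
    calm : ExcludedMiddle 0ℓ → ∀ τ → ¬ Jump τ → Calm τ
    calm em τ ¬jump u b with nearly-least em τ
    ... | v , a , least with em {∃[ i ] spent i τ ≤ 4 ⋆ v}
    ...   | yes (i , c≤4v) = i ,
      linear 3 (λ c u v → c :≤ 4 :⋆ v ⇒ v :≤ 2 :⋆ u ⇒ ⊢ c :≤ 8 :⋆ u) (1 ∷ 4 ∷ []) refl
        c≤4v (least u b)
    ...   | no none = ⊥-elim (¬jump (v , (a , least) , λ i c≤4v → none (i , c≤4v)))

    -- The last step of the strategy X serves q. Before it, the leader's taxis join X, whose path
    -- has started within v of theirs.
    jump-move : ∀ {q τ v} (a : Admissible (q ∷ τ) v) → ∃[ c ]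
      Move (position p τ) (proj₁ q) (leading τ) (Admissible.X a) c ×
      c ≤ v + spent (leader τ) τ + Admissible.κ a
    jump-move {q} {τ} {v} record { path = _∷_ {κ = κ} {c} m ms ; start = h } =
      v + (spent (leader τ) τ + κ) + c , record
        { near  = path-near (pursuit-path (leader τ) τ) ms (left , left , h)
        ; step  = m
        ; total = ≤-refl
        } , linear 4 (λ v s k c → ⊢ v :+ (s :+ k) :+ c :≤ v :+ s :+ (k :+ c)) [] refl

    -- The potential is 800 (z + m), where m is the distance from Y to the offline taxis.
    calm-cost : ∀ {τ T X₀ X κ m} → Calm τ → Balanced (leader τ) τ T →
      Path p X₀ τ X κ → gap Y X₀ left left ≤ m → T ≤ 800 ⋆ z + 800 ⋆ m + 40000 ⋆ κ
    calm-cost {τ} {T} {X₀} {X} {κ} {m} quiet balanced path start = conclude (quiet u admissible)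
      where
      -- Admissible through the offline path itself, so that T is at most 80 u.
      u = z + m + 32 ⋆ κ
      0≤κ = path-nonNeg path
      0≤m = ≤-trans (gap-nonNeg Y X₀ left left) start
      admissible : Admissible τ u
      admissible = record
        { path       = path
        ; start      = linear 4 (λ g z m k → g :≤ m ⇒ :0 :≤ z ⇒ :0 :≤ k ⇒
          ⊢ g :≤ z :+ m :+ 32 :⋆ k) (1 ∷ 1 ∷ 32 ∷ []) refl start 0≤z 0≤κ
        ; affordable = linear 3 (λ z m k → :0 :≤ z ⇒ :0 :≤ m ⇒ ⊢ 32 :⋆ k :≤ z :+ m :+ 32 :⋆ k)
          (1 ∷ 1 ∷ []) refl 0≤z 0≤m
        ; coarse     = linear 3 (λ z m k → :0 :≤ m ⇒ :0 :≤ k ⇒ ⊢ z :≤ z :+ m :+ 32 :⋆ k)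
          (1 ∷ 32 ∷ []) refl 0≤m 0≤κ
        }
      conclude : ∃[ i ] spent i τ ≤ 8 ⋆ u → T ≤ 800 ⋆ z + 800 ⋆ m + 40000 ⋆ κ
      conclude (i , c≤8u) =
        linear 5 (λ T c z m k → T :≤ 10 :⋆ c ⇒ c :≤ 8 :⋆ (z :+ m :+ 32 :⋆ k) ⇒ :0 :≤ z ⇒
          :0 :≤ m ⇒ :0 :≤ k ⇒ ⊢ T :≤ 800 :⋆ z :+ 800 :⋆ m :+ 40000 :⋆ k)
          (1 ∷ 10 ∷ 720 ∷ 720 ∷ 37440 ∷ []) refl
          (balanced-cost balanced i) c≤8u 0≤z 0≤m 0≤κ

    -- As the stage was calm before q, its cost and that of the jump are O(v). Either the offline
    -- cost is of order v, or X is near the offline taxis and the new potential is small.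
    jump-cost : ∀ {q τ v w T c X₀ X κ m} → Calm τ → Balanced (leader τ) τ T →
      (a : Admissible (q ∷ τ) v) → (∀ u → Admissible (q ∷ τ) u → v ≤ 2 ⋆ u) →
      (∀ i → ¬ spent i (q ∷ τ) ≤ 4 ⋆ v) →
      c ≤ v + spent (leader τ) τ + Admissible.κ a → 4 ⋆ w ≡ v →
      Path p X₀ (q ∷ τ) X κ → gap Y X₀ left left ≤ m →
      ∃[ m′ ] Near (Admissible.X a) X m′ ×
        T + c + 800 ⋆ w + 800 ⋆ m′ ≤ 800 ⋆ z + 800 ⋆ m + 40000 ⋆ κ
    jump-cost {q} {τ} {v} {w} {T} {c} {X₀} {X} {κ} {m} quiet balanced a least costly c≤ 4w≡v path start
      with quiet v (admissible-tail a) | total (32 ⋆ κ) v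
    -- The way through Y serves as the new distance. Beyond 800 m, less than 1123 v + 800 κ is to be
    -- paid, which 40000 κ covers.
    ... | i , s≤8v | inj₂ v≤32κ = _ , path-near (Admissible.path a) path
        (near-trans (near-sym (left , left , Admissible.start a)) (left , left , start)) ,
      linear 10 (λ T c v w s l k k' m z → T :≤ 10 :⋆ s ⇒ l :≤ 2 :⋆ s ⇒ s :≤ 8 :⋆ v ⇒
        c :≤ v :+ l :+ k ⇒ 4 :⋆ w :≤ v ⇒ 32 :⋆ k :≤ v ⇒ v :≤ 32 :⋆ k' ⇒ :0 :≤ k' ⇒ :0 :≤ z ⇒
        ⊢ T :+ c :+ 800 :⋆ w :+ 800 :⋆ (v :+ m :+ (k :+ k')) :≤ 800 :⋆ z :+ 800 :⋆ m :+ 40000 :⋆ k')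
        (32 ∷ 32 ∷ 384 ∷ 32 ∷ 6400 ∷ 801 ∷ 35905 ∷ 105440 ∷ 25600 ∷ 31 ∷ []) refl
        (balanced-cost balanced i) (balanced-leader balanced i) s≤8v c≤ (≤-reflexive 4w≡v)
        (Admissible.affordable a) v≤32κ (path-nonNeg path) 0≤z
    ... | i , s≤8v | inj₁ 32κ≤v with pursuit-or-near
          (λ j → ≤-trans (gap-component Y _ left j) (Admissible.start a)) (Admissible.path a) path
    -- 3 v + 15 (v / 32 + v / 32) is at most 4 v, against `costly`.
    ...   | inj₁ (k , cheap) = ⊥-elim (costly k
      (linear 4 (λ s v k k' → s :≤ 3 :⋆ v :+ 15 :⋆ (k :+ k') ⇒ 32 :⋆ k :≤ v ⇒ 32 :⋆ k' :≤ v ⇒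
        :0 :≤ v ⇒ ⊢ s :≤ 4 :⋆ v) (32 ∷ 15 ∷ 15 ∷ 2 ∷ 31 ∷ []) refl
        cheap (Admissible.affordable a) 32κ≤v (admissible-nonNeg a)))
    ...   | inj₂ aX = _ , aX , conclude
      where
      0≤m = ≤-trans (gap-nonNeg Y X₀ left left) start
      bound : T + c + 800 ⋆ w + 800 ⋆ (2 ⋆ (Admissible.κ a + κ)) ≤ 400 ⋆ v
      -- In units of v: 80 for T, slightly over 17 for c, 200 for w, and 100 for the distance of at
      -- most v / 8.
      bound = linear 8 (λ T c v w s l k k' → T :≤ 10 :⋆ s ⇒ l :≤ 2 :⋆ s ⇒ s :≤ 8 :⋆ v ⇒
        c :≤ v :+ l :+ k ⇒ 4 :⋆ w :≤ v ⇒ 32 :⋆ k :≤ v ⇒ 32 :⋆ k' :≤ v ⇒ :0 :≤ v ⇒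
        ⊢ T :+ c :+ 800 :⋆ w :+ 800 :⋆ (2 :⋆ (k :+ k')) :≤ 400 :⋆ v)
        (32 ∷ 32 ∷ 384 ∷ 32 ∷ 6400 ∷ 1601 ∷ 1600 ∷ 95 ∷ 31 ∷ []) refl
        (balanced-cost balanced i) (balanced-leader balanced i) s≤8v c≤ (≤-reflexive 4w≡v)
        (Admissible.affordable a) 32κ≤v (admissible-nonNeg a)
      least-of : ∀ u → z ≤ u → m ≤ u → 32 ⋆ κ ≤ u → v ≤ 2 ⋆ u
      least-of u z≤u m≤u 32κ≤u = least u (record
        { path = path ; start = ≤-trans start m≤u ; affordable = 32κ≤u ; coarse = z≤u })
      -- The offline path makes the largest of z, m and `32 ⋆ κ` admissible. Hence 400 v is at most
      -- 800 times that, which fixes the weight of the potential.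
      dominant : v ≤ 2 ⋆ z ⊎ v ≤ 2 ⋆ m ⊎ v ≤ 2 ⋆ 32 ⋆ κ
      dominant with total z m | total z (32 ⋆ κ) | total m (32 ⋆ κ)
      ... | inj₁ z≤m | _         | inj₁ m≤κ = inj₂ (inj₂ (least-of _ (≤-trans z≤m m≤κ) m≤κ ≤-refl))
      ... | inj₁ z≤m | _         | inj₂ κ≤m = inj₂ (inj₁ (least-of _ z≤m ≤-refl κ≤m))
      ... | inj₂ m≤z | inj₁ z≤κ  | _        = inj₂ (inj₂ (least-of _ z≤κ (≤-trans m≤z z≤κ) ≤-refl))
      ... | inj₂ m≤z | inj₂ κ≤z  | _        = inj₁ (least-of _ ≤-refl m≤z κ≤z)
      conclude : T + c + 800 ⋆ w + 800 ⋆ (2 ⋆ (Admissible.κ a + κ)) ≤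
                 800 ⋆ z + 800 ⋆ m + 40000 ⋆ κ
      conclude with dominant
      ... | inj₁ v≤2z = linear 5 (λ A v z m k → A :≤ 400 :⋆ v ⇒ v :≤ 2 :⋆ z ⇒ :0 :≤ m ⇒ :0 :≤ k ⇒
        ⊢ A :≤ 800 :⋆ z :+ 800 :⋆ m :+ 40000 :⋆ k) (1 ∷ 400 ∷ 800 ∷ 40000 ∷ []) refl
        bound v≤2z 0≤m (path-nonNeg path)
      ... | inj₂ (inj₁ v≤2m) = linear 5 (λ A v z m k → A :≤ 400 :⋆ v ⇒ v :≤ 2 :⋆ m ⇒ :0 :≤ z ⇒
        :0 :≤ k ⇒ ⊢ A :≤ 800 :⋆ z :+ 800 :⋆ m :+ 40000 :⋆ k) (1 ∷ 400 ∷ 800 ∷ 40000 ∷ []) refl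
        bound v≤2m 0≤z (path-nonNeg path)
      ... | inj₂ (inj₂ v≤κ) = linear 5 (λ A v z m k → A :≤ 400 :⋆ v ⇒ v :≤ 2 :⋆ 32 :⋆ k ⇒
        :0 :≤ z ⇒ :0 :≤ m ⇒ :0 :≤ k ⇒ ⊢ A :≤ 800 :⋆ z :+ 800 :⋆ m :+ 40000 :⋆ k)
        (1 ∷ 400 ∷ 800 ∷ 800 ∷ 14400 ∷ []) refl bound v≤κ 0≤z 0≤m (path-nonNeg path)

  -- States of the algorithm and the amortised analysis.

  record State : Set where
    constructor _since_
    field
      root     : Root
      requests : List Request′

    open Root root public
    open Stage root public
    open Pursuit p Y public using (leader; leading; Balanced)

    here : ℝ
    here = position p requests

    others : Pair
    others = leading requests

  open State

  Decision : State → Request′ → Set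
  Decision S q = Dec (Jump S (q ∷ requests S))

  decide : ExcludedMiddle 0ℓ → ∀ S q → Decision S q
  decide em S q = em

  positive-quarter : ∀ {w v} → 4 ⋆ w ≡ v → ¬ v ≤ 0# → ¬ w ≤ 0#
  positive-quarter refl v≰0 w≤0 = v≰0 (linear 1 (λ w → w :≤ :0 ⇒ ⊢ 4 :⋆ w :≤ :0) (4 ∷ []) refl w≤0)

  after : ∀ S q → Decision S q → State
  after S q (no _) = root S since (q ∷ requests S)
  after S (s , t) (yes (v , (a , _) , _)) = record
    { p   = t
    ; Y   = Stage.Admissible.X a
    -- With a quarter of v, the uncertainty adds only 200 v to the new potential.
    ; z   = proj₁ (divide 3 v)
    ; z≰0 = positive-quarter (proj₂ (divide 3 v)) λ v≤0 → z≰0 S (≤-trans (Stage.Admissible.coarse a) v≤0)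
    } since []

  here-after : ∀ S q dec → here (after S q dec) ≡ proj₂ q
  here-after S q (yes _) = refl
  here-after S q (no _)  = refl

  travel : ∀ S q dec → ∃[ c ] Move (here S) (proj₁ q) (others S) (others (after S q dec)) c
  travel S q (no _) with c , m , _ ← Pursuit.follow (p S) (Y S) q (requests S) = c , m
  travel S q (yes (v , (a , _) , _)) with c , m , _ ← jump-move S a = c , m

  -- `start` in `Invariant` compares slots in order, while a jump bounds some matching only, so the
  -- offline slots are renamed.
  reorder : Side → Pair → Pair
  reorder i X = X ‼ i , X ‼ flip i

  -- The cost T of the stage so far, and a bound V on the potential at its start plus the ratio
  -- times the offline cost since then, when the offline taxis are at X.
  record Invariant (S : State) (T : ℝ) (X : Pair) (V : ℝ) : Set where
    field
      {X₀}      : Pair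
      {κ m}     : ℝ
      balanced  : Balanced S (leader S (requests S)) (requests S) T
      quiet     : Calm S (requests S)
      path      : Path (p S) X₀ (requests S) X κ
      start     : gap (Y S) X₀ left left ≤ m
      potential : 800 ⋆ z S + 800 ⋆ m + 40000 ⋆ κ ≤ V

  invariant-cost : ∀ {S T X V} → Invariant S T X V → T ≤ V
  invariant-cost {S} inv = ≤-trans (calm-cost S quiet balanced path start) potential
    where open Invariant inv

  -- V - T, nonnegative by `invariant-cost`, is a credit: it falls by at least the cost of `travel`
  -- minus 40000 s. A jump resets T and replaces V by the new potential.
  invariant-step : ExcludedMiddle 0ℓ → ∀ {S T X V} q {X′ s} → Invariant S T X V →
    Step (here S) (proj₁ q) X X′ s → ∀ dec →
    ∃[ i ] ∃[ T′ ] ∃[ V′ ] Invariant (after S q dec) T′ (reorder i X′) V′ ×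
      T + proj₁ (travel S q dec) + V′ ≤ T′ + (V + 40000 ⋆ s)
  invariant-step em {S} {T} {X} {V} q {X′} {s} inv m′ (no ¬jump) =
    left , T + c , V + 40000 ⋆ s , record
      { balanced  = proj₂ (proj₂ follow-q) T balanced
      ; quiet     = calm S em (q ∷ requests S) ¬jump
      ; path      = m′ ∷ path
      ; start     = start
      ; potential = linear 5 (λ z m k s V → 800 :⋆ z :+ 800 :⋆ m :+ 40000 :⋆ k :≤ V ⇒
        ⊢ 800 :⋆ z :+ 800 :⋆ m :+ 40000 :⋆ (k :+ s) :≤ V :+ 40000 :⋆ s) (1 ∷ []) refl potential
      } , ≤-refl
    where
    open Invariant inv
    follow-q = Pursuit.follow (p S) (Y S) q (requests S)
    c = proj₁ follow-q
  invariant-step em {S} {T} {X} {V} q {X′} {s} inv m′ (yes (v , (a , least) , costly))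
    with m″ , aX , bound ← jump-cost S (Invariant.quiet inv) (Invariant.balanced inv) a least costly
           (proj₂ (proj₂ (jump-move S a))) (proj₂ (divide 3 v))
           (m′ ∷ Invariant.path inv) (Invariant.start inv)
    with i , g ← near-at aX left =
    i , 0# , 800 ⋆ w + 800 ⋆ m″ , record
      { balanced  = Pursuit.balanced-[] (proj₂ q) (Stage.Admissible.X a)
      ; quiet     = Stage.calm-[] _
      ; path      = []
      ; start     = g
      ; potential = linear 2 (λ w m →
        ⊢ 800 :⋆ w :+ 800 :⋆ m :+ 40000 :⋆ :0 :≤ 800 :⋆ w :+ 800 :⋆ m) [] refl
      } ,
      linear 8 (λ A w m'' z m k s V →
        A :+ 800 :⋆ w :+ 800 :⋆ m'' :≤ 800 :⋆ z :+ 800 :⋆ m :+ 40000 :⋆ (k :+ s) ⇒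
        800 :⋆ z :+ 800 :⋆ m :+ 40000 :⋆ k :≤ V ⇒
        ⊢ A :+ (800 :⋆ w :+ 800 :⋆ m'') :≤ :0 :+ (V :+ 40000 :⋆ s)) (1 ∷ 1 ∷ []) refl
        bound (Invariant.potential inv)
    where
    w = proj₁ (divide 3 v)

-- From pairs to three named taxis.

module Arrangements (R : Reals) where
  open Reals R
  open LinearArithmetic R
  open Distance R
  open Game R
  open Stages R using (reorder)

  Taxis : Set
  Taxis = Config R (line R) 3

  Trip : Request′ → Set
  Trip = Service R (line R) 3

  travelled : Taxis → Taxis → ℝ
  travelled = distance R (line R) 3

  place : Fin 3 → ℝ → ℝ → ℝ → Taxis
  place zero             p x y = p ∷ x ∷ y ∷ []
  place (suc zero)       p x y = x ∷ p ∷ y ∷ []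
  place (suc (suc zero)) p x y = x ∷ y ∷ p ∷ []

  -- The name of the taxi at p, and the slot of the first of the other two.
  Arrangement : Set
  Arrangement = Fin 3 × Side

  arrange : Arrangement → ℝ → Pair → Taxis
  arrange (n , i) p X = place n p (X ‼ i) (X ‼ flip i)

  place-travelled : ∀ n p x y q u v →
    travelled (place n p x y) (place n q u v) ≡ d p q + (d x u + d y v)
  place-travelled zero p x y q u v = cong (λ z → d p q + (d x u + z)) (+-identityʳ _)
  place-travelled (suc zero) p x y q u v = antisym
    (linear 3 (λ a b c → ⊢ a :+ (b :+ (c :+ :0)) :≤ b :+ (a :+ c)) [] refl)
    (linear 3 (λ a b c → ⊢ b :+ (a :+ c) :≤ a :+ (b :+ (c :+ :0))) [] refl)
  place-travelled (suc (suc zero)) p x y q u v = antisym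
    (linear 3 (λ a b c → ⊢ a :+ (b :+ (c :+ :0)) :≤ c :+ (a :+ b)) [] refl)
    (linear 3 (λ a b c → ⊢ c :+ (a :+ b) :≤ a :+ (b :+ (c :+ :0))) [] refl)

  place-lookup : ∀ n p x y → lookup (place n p x y) n ≡ p
  place-lookup zero             p x y = refl
  place-lookup (suc zero)       p x y = refl
  place-lookup (suc (suc zero)) p x y = refl

  place-update : ∀ n p x y t → updateᵛ (place n p x y) n t ≡ place n t x y
  place-update zero             p x y t = refl
  place-update (suc zero)       p x y t = refl
  place-update (suc (suc zero)) p x y t = refl

  arrange-travelled : ∀ π p X q Z →
    travelled (arrange π p X) (arrange π q Z) ≡ d p q + gap X Z left left
  arrange-travelled (n , i) p X q Z = trans
    (place-travelled n p (X ‼ i) (X ‼ flip i) q (Z ‼ i) (Z ‼ flip i))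
    (cong (d p q +_) (gap-diagonal X Z i))

  arrange-reorder : ∀ π p i X → ∃[ π′ ] arrange π p X ≡ arrange π′ p (reorder i X)
  arrange-reorder (n , left)  p left  X = (n , left)  , refl
  arrange-reorder (n , right) p left  X = (n , right) , refl
  arrange-reorder (n , left)  p right X = (n , right) , refl
  arrange-reorder (n , right) p right X = (n , left)  , refl

  unarrange : ∀ π C → ∃[ p ] ∃[ X ] C ≡ arrange π p X
  unarrange (zero           , left)  (a ∷ b ∷ c ∷ []) = a , (b , c) , refl
  unarrange (zero           , right) (a ∷ b ∷ c ∷ []) = a , (c , b) , refl
  unarrange (suc zero       , left)  (a ∷ b ∷ c ∷ []) = b , (a , c) , refl
  unarrange (suc zero       , right) (a ∷ b ∷ c ∷ []) = b , (c , a) , refl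
  unarrange (suc (suc zero) , left)  (a ∷ b ∷ c ∷ []) = c , (a , b) , refl
  unarrange (suc (suc zero) , right) (a ∷ b ∷ c ∷ []) = c , (b , a) , refl

  -- The taxi in slot j becomes the distinguished one.
  exchange : Arrangement → Side → Arrangement
  exchange (zero           , left)  left  = suc zero , left
  exchange (zero           , left)  right = suc (suc zero) , right
  exchange (zero           , right) right = suc zero , right
  exchange (zero           , right) left  = suc (suc zero) , left
  exchange (suc zero       , left)  left  = zero , left
  exchange (suc zero       , left)  right = suc (suc zero) , left
  exchange (suc zero       , right) right = zero , right
  exchange (suc zero       , right) left  = suc (suc zero) , right
  exchange (suc (suc zero) , left)  left  = zero , right
  exchange (suc (suc zero) , left)  right = suc zero , left
  exchange (suc (suc zero) , right) right = zero , left
  exchange (suc (suc zero) , right) left  = suc zero , right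

  arrange-exchange : ∀ π j p X → arrange π p X ≡ arrange (exchange π j) (X ‼ j) (X [ j ≔ p ])
  arrange-exchange (zero           , left)  left  p X = refl
  arrange-exchange (zero           , left)  right p X = refl
  arrange-exchange (zero           , right) right p X = refl
  arrange-exchange (zero           , right) left  p X = refl
  arrange-exchange (suc zero       , left)  left  p X = refl
  arrange-exchange (suc zero       , left)  right p X = refl
  arrange-exchange (suc zero       , right) right p X = refl
  arrange-exchange (suc zero       , right) left  p X = refl
  arrange-exchange (suc (suc zero) , left)  left  p X = refl
  arrange-exchange (suc (suc zero) , left)  right p X = refl
  arrange-exchange (suc (suc zero) , right) right p X = refl
  arrange-exchange (suc (suc zero) , right) left  p X = refl

  by-name : ∀ π n → n ≡ proj₁ π ⊎ ∃[ j ] n ≡ proj₁ (exchange π j)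
  by-name (zero           , left)  zero             = inj₁ refl
  by-name (zero           , left)  (suc zero)       = inj₂ (left , refl)
  by-name (zero           , left)  (suc (suc zero)) = inj₂ (right , refl)
  by-name (zero           , right) zero             = inj₁ refl
  by-name (zero           , right) (suc zero)       = inj₂ (right , refl)
  by-name (zero           , right) (suc (suc zero)) = inj₂ (left , refl)
  by-name (suc zero       , left)  zero             = inj₂ (left , refl)
  by-name (suc zero       , left)  (suc zero)       = inj₁ refl
  by-name (suc zero       , left)  (suc (suc zero)) = inj₂ (right , refl)
  by-name (suc zero       , right) zero             = inj₂ (right , refl)
  by-name (suc zero       , right) (suc zero)       = inj₁ refl
  by-name (suc zero       , right) (suc (suc zero)) = inj₂ (left , refl)
  by-name (suc (suc zero) , left)  zero             = inj₂ (left , refl)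
  by-name (suc (suc zero) , left)  (suc zero)       = inj₂ (right , refl)
  by-name (suc (suc zero) , left)  (suc (suc zero)) = inj₁ refl
  by-name (suc (suc zero) , right) zero             = inj₂ (right , refl)
  by-name (suc (suc zero) , right) (suc zero)       = inj₂ (left , refl)
  by-name (suc (suc zero) , right) (suc (suc zero)) = inj₁ refl

  update-update : ∀ X j x → X [ j ≔ x ] [ j ≔ X ‼ j ] ≡ X
  update-update X left  x = refl
  update-update X right x = refl

  travelled-self : ∀ C → travelled C C ≤ 0#
  travelled-self (x ∷ y ∷ z ∷ []) =
    linear 3 (λ a b c → a :≤ :0 ⇒ b :≤ :0 ⇒ c :≤ :0 ⇒ ⊢ a :+ (b :+ (c :+ :0)) :≤ :0)
      (1 ∷ 1 ∷ 1 ∷ []) refl (d-self x) (d-self y) (d-self z)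

  travelled-nonNeg : ∀ C D → 0# ≤ travelled C D
  travelled-nonNeg C D = sum-nonNeg (λ i → d (lookup C i) (lookup D i)) (λ _ → d-nonNeg _ _)

  travelled-triangle : ∀ C D E → travelled C E ≤ travelled C D + travelled D E
  travelled-triangle (x ∷ y ∷ z ∷ []) (x′ ∷ y′ ∷ z′ ∷ []) (x″ ∷ y″ ∷ z″ ∷ []) =
    linear 9 (λ a b c a' b' c' a'' b'' c'' → a :≤ a' :+ a'' ⇒ b :≤ b' :+ b'' ⇒ c :≤ c' :+ c'' ⇒
      ⊢ a :+ (b :+ (c :+ :0)) :≤ a' :+ (b' :+ (c' :+ :0)) :+ (a'' :+ (b'' :+ (c'' :+ :0))))
      (1 ∷ 1 ∷ 1 ∷ []) refl
      (triangle x x′ x″) (triangle y y′ y″) (triangle z z′ z″)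

  trip : Arrangement → ∀ q → Pair → Trip q
  trip (n , i) (s , t) X = record
    { pickup    = arrange (n , i) s X
    ; server    = n
    ; at-source = place-lookup n s _ _
    ; final     = arrange (n , i) t X
    }

  trip-cost : ∀ C π q X → Service.cost-from (trip π q X) C ≤ travelled C (arrange π (proj₁ q) X)
  trip-cost C (n , i) (s , t) X rewrite place-update n s (X ‼ i) (X ‼ flip i) t =
    linear 2 (λ a b → b :≤ :0 ⇒ ⊢ a :+ b :≤ a) (1 ∷ []) refl (travelled-self (arrange (n , i) t X))

  -- If slot j serves, its taxi ends at r and the one from p in slot j, so that the two exchange
  -- roles.
  step-arrangement : ∀ π {p r X X′ c} → Step p r X X′ c →
    ∃[ π′ ] travelled (arrange π p X) (arrange π′ r X′) ≤ c
  step-arrangement π {p} {r} {X} {X′} (keep h) =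
    π , ≤-trans (≤-reflexive (arrange-travelled π p X r X′)) h
  step-arrangement π {p} {r} {X} {X′} {c} (use j h) = exchange π j ,
    subst (λ C → travelled (arrange π p X) C ≤ c) same-taxis
      (≤-trans (≤-reflexive (arrange-travelled π p X (X′ ‼ j) (X′ [ j ≔ r ])))
        (subst (λ g → d p (X′ ‼ j) + g ≤ c) (gap-diagonal X (X′ [ j ≔ r ]) j)
          (subst₂ (λ u v → d p (X′ ‼ j) + (d (X ‼ j) u + d (X ‼ flip j) v) ≤ c)
            (sym (‼-update X′ j r)) (sym (‼-update-flip X′ j r))
            (linear 4 (λ a b x c → a :+ (b :+ x) :≤ c ⇒ ⊢ b :+ (a :+ x) :≤ c) (1 ∷ []) refl h))))
    where
    same-taxis : arrange π (X′ ‼ j) (X′ [ j ≔ r ]) ≡ arrange (exchange π j) r X′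
    same-taxis = trans (arrange-exchange π j (X′ ‼ j) (X′ [ j ≔ r ]))
      (cong₂ (arrange (exchange π j)) (‼-update X′ j r) (update-update X′ j r))

  near-arrangement : ∀ π p {X Z e} → Near X Z e →
    ∃[ π′ ] travelled (arrange π p X) (arrange π′ p Z) ≤ e
  near-arrangement (n , i) p {X} {Z} {e} XZ with near-at XZ i
  ... | j , g = (n , j) , subst (_≤ e)
    (sym (place-travelled n p (X ‼ i) (X ‼ flip i) p (Z ‼ j) (Z ‼ flip j)))
    (linear 3 (λ a g e → a :≤ :0 ⇒ g :≤ e ⇒ ⊢ a :+ g :≤ e) (1 ∷ 1 ∷ []) refl (d-self p) g)

  realise : ∀ π {p X X′ c} q → Move p (proj₁ q) X X′ c →
    ∃[ π′ ] Service.cost-from (trip π′ q X′) (arrange π p X) ≤ c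
  realise π {p} {X} {X′} q record { middle = Z ; near = XZ ; step = m ; total = before+during≤c }
    with π₁ , g ← near-arrangement π p XZ
    with π₂ , h ← step-arrangement π₁ m = π₂ ,
    linear 7 (λ f cd cz zd e s c → f :≤ cd ⇒ cd :≤ cz :+ zd ⇒ cz :≤ e ⇒ zd :≤ s ⇒ e :+ s :≤ c ⇒
      ⊢ f :≤ c) (1 ∷ 1 ∷ 1 ∷ 1 ∷ 1 ∷ []) refl
      (trip-cost (arrange π p X) π₂ q X′)
      (travelled-triangle (arrange π p X) (arrange π₁ p Z) (arrange π₂ (proj₁ q) X′))
      g h before+during≤c

  use-step : ∀ π j p X u W {r} → W ‼ j ≡ r →
    Step p r X (W [ j ≔ u ]) (travelled (arrange π p X) (arrange π u W))
  use-step π j p X u W refl = use j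
    (subst₂ (λ a b → d (X ‼ j) (W ‼ j) + (d p a + d (X ‼ flip j) b) ≤
        travelled (arrange π p X) (arrange π u W))
      (sym (‼-update W j u)) (sym (‼-update-flip W j u))
      (linear 5 (λ a b x g T → a :+ x :≤ g ⇒ b :+ g :≤ T ⇒ ⊢ a :+ (b :+ x) :≤ T)
        (1 ∷ 1 ∷ []) refl
        (≤-reflexive (gap-diagonal X W j))
        (≤-reflexive (sym (arrange-travelled π p X u W)))))

  -- Any service is a step: unless the taxi from p serves, it counts as slot j of the server from
  -- now on, wherever it has gone.
  trip-step : ∀ π p X {q} (o : Trip q) →
    ∃[ X′ ] ∃[ π′ ] Service.dropoff o ≡ arrange π′ (proj₂ q) X′ ×
      Step p (proj₁ q) X X′ (travelled (arrange π p X) (Service.pickup o))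
  trip-step π p X {s , t} record { pickup = C ; server = n ; at-source = source }
    with unarrange π C | by-name π n
  ... | u , W , refl | inj₁ refl = W , π , place-update (proj₁ π) u _ _ t ,
    keep (≤-reflexive (trans
      (cong (λ v → d p v + gap X W left left) (trans (sym source) (place-lookup (proj₁ π) u _ _)))
      (sym (arrange-travelled π p X u W))))
  ... | u , W , refl | inj₂ (j , refl) = W [ j ≔ u ] , exchange π j ,
    trans (cong (λ D → updateᵛ D m t) exchanged) (place-update m (W ‼ j) _ _ t) ,
    use-step π j p X u W (trans (sym (place-lookup m (W ‼ j) _ _))
      (trans (cong (λ D → lookup D m) (sym exchanged)) source))
    where
    m = proj₁ (exchange π j)
    exchanged = arrange-exchange π j u W

-- Schedules produced by a run.

module _ {R : Reals} {M : MetricSpace R} {k : ℕ} where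

  -- The schedules produced by run after the requests in past, as run itself is defined by a
  -- function that has no name.
  data Trace (A : DeterministicOnlineAlgorithm R M k) (C : Config R M k) :
       List (Request R M k) → ∀ {σ} → Schedule R M k σ → Set where
    []  : ∀ {past} → Trace A C past []
    [_] : ∀ {past q σ} {ms : Schedule R M k σ} → Trace A C (past ∷ʳ q) ms →
          Trace A C past (A C past q ∷ ms)

  -- The schedule left open in the type of go-trace is solved for by its use in run-trace, where
  -- the empty past in the unfolding of run has been generalised.
  mutual
    go-trace : ∀ A C past σ → Trace A C past {σ} _

    run-trace : ∀ A C σ → Trace A C [] (run R M k A C σ)
    run-trace A C σ with List (Request R M k) ∋ []
    ... | past = go-trace A C past σ

    go-trace A C past []      = []
    go-trace A C past (q ∷ σ) = [ go-trace A C (past ∷ʳ q) σ ]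

-- The online algorithm and its ratio.

module Algorithm (em : ExcludedMiddle 0ℓ) (R : Reals) where
  open Reals R
  open LinearArithmetic R
  open OrderedField R
  open Distance R
  open Game R
  open Stages R
  open State
  open Arrangements R

  Fleet : Set
  Fleet = State × Arrangement

  positions : Fleet → Taxis
  positions (S , π) = arrange π (here S) (others S)

  1≰0 : ¬ 1# ≤ 0#
  1≰0 1≤0 = 0≢1 (antisym 0≤1 1≤0)

  -- The first taxi stands in for the one at the last destination. The uncertainty 1 is an arbitrary
  -- positive choice and yields the additive constant 800.
  initial-root : Taxis → Root
  initial-root (p ∷ x ∷ y ∷ []) = record { p = p ; Y = x , y ; z = 1# ; z≰0 = 1≰0 }

  initial : Taxis → Fleet
  initial C = initial-root C since [] , zero , left

  advance : Fleet → Request′ → Fleet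
  advance (S , π) q = after S q dec , proj₁ (realise π q (proj₂ (travel S q dec)))
    where dec = decide em S q

  fleet : Taxis → List Request′ → Fleet
  fleet C = foldl advance (initial C)

  algorithm : DeterministicOnlineAlgorithm R (line R) 3
  algorithm C past q with advance (fleet C past) q
  ... | S , π = trip π q (others S)

  cost-of : ∀ {σ} → Taxis → Schedule R (line R) 3 σ → ℝ
  cost-of = cost R (line R) 3

  -- The offline taxis are accounted for as at their last drop-off, where one of them coincides with
  -- an online taxi; their way from there to their true places D is charged with the next pickup.
  cost-bound : ∀ {C past σ} {ms : Schedule R (line R) 3 σ} → Trace algorithm C past ms →
    ∀ F → fleet C past ≡ F → ∀ {T X V} → Invariant (proj₁ F) T X V →
    ∀ π D (opt : Schedule R (line R) 3 σ) →
    T + cost-of (positions F) ms ≤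
      V + 40000 ⋆ (travelled (arrange π (here (proj₁ F)) X) D + cost-of D opt)
  cost-bound [] F refl {T} {X} inv π D [] =
    linear 3 (λ T V a → T :≤ V ⇒ :0 :≤ a ⇒ ⊢ T :+ :0 :≤ V :+ 40000 :⋆ (a :+ :0))
      (1 ∷ 40000 ∷ []) refl (invariant-cost inv)
      (travelled-nonNeg (arrange π (here (proj₁ F)) X) D)
  cost-bound {C} {past} ([_] {q = q} {ms = ms} trace) F refl {T} {X} {V} inv π D (o ∷ opt) =
    let S                               = proj₁ F
        S′ , π₁                         = advance F q
        X′ , π′ , dropped , m           = trip-step π (here S) X o
        i , T′ , V′ , inv′ , charge     = invariant-step em q inv m (decide em S q)
        π″ , reordered                  = arrange-reorder π′ (proj₂ q) i X′
        arrives                         = here-after S q (decide em S q)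
        rest = cost-bound trace (S′ , π₁) (foldl-∷ʳ advance (initial C) q past) inv′ π″
                 (Service.final o) opt
    in linear 12 (λ T V c f rest T' V' s e k a b → T :+ c :+ V' :≤ T' :+ (V :+ 40000 :⋆ s) ⇒
      f :≤ c ⇒ T' :+ rest :≤ V' :+ 40000 :⋆ (e :+ k) ⇒ s :≤ a :+ b ⇒
      ⊢ T :+ (f :+ rest) :≤ V :+ 40000 :⋆ (a :+ (b :+ e :+ k))) (1 ∷ 1 ∷ 1 ∷ 40000 ∷ []) refl
      charge
      (proj₂ (realise (proj₂ F) q (proj₂ (travel S q (decide em S q)))))
      (subst₂ (λ P Q → T′ + cost-of P ms ≤
          V′ + 40000 ⋆ (travelled Q (Service.final o) + cost-of (Service.final o) opt))
        (cong (λ p → arrange π₁ p (others S′)) arrives)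
        (trans (cong (λ p → arrange π″ p (reorder i X′)) arrives)
          (trans (sym reordered) (sym dropped)))
        rest)
      (travelled-triangle (arrange π (here S) X) D (Service.pickup o))

  initial-invariant : ∀ C → let ρ = initial-root C in
    Invariant (ρ since []) 0# (Root.Y ρ) (800 ⋆ Root.z ρ)
  initial-invariant C = record
    { balanced  = Pursuit.balanced-[] (Root.p ρ) (Root.Y ρ)
    ; quiet     = Stage.calm-[] ρ
    ; path      = []
    ; start     = ≤-reflexive refl
    ; potential = linear 2 (λ z g → g :≤ :0 ⇒ ⊢ 800 :⋆ z :+ 800 :⋆ g :+ 40000 :⋆ :0 :≤ 800 :⋆ z)
      (800 ∷ []) refl
        (linear 2 (λ a b → a :≤ :0 ⇒ b :≤ :0 ⇒ ⊢ a :+ b :≤ :0) (1 ∷ 1 ∷ []) refl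
          (d-self (proj₁ (Root.Y ρ))) (d-self (proj₂ (Root.Y ρ))))
    }
    where ρ = initial-root C

  algorithm-cost : ∀ C σ (opt : Schedule R (line R) 3 σ) →
    cost-of C (run R (line R) 3 algorithm C σ) ≤ 800 ⋆ 1# + 40000 ⋆ cost-of C opt
  algorithm-cost C@(_ ∷ _ ∷ _ ∷ []) σ opt =
    linear 4 (λ A c k s → :0 :+ A :≤ c :+ 40000 :⋆ (s :+ k) ⇒ s :≤ :0 ⇒ ⊢ A :≤ c :+ 40000 :⋆ k)
      (1 ∷ 40000 ∷ []) refl
      (cost-bound (run-trace algorithm C σ) (initial C) refl (initial-invariant C) (zero , left) C opt)
      (travelled-self C)

  -- `OPT` is an infimum: (A - 800) / 40000 is a lower bound of all offline costs and hence at most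
  -- `OPT`.
  algorithm-competitive : ∀ C σ → cost-of C (run R (line R) 3 algorithm C σ) ≤
    (40000 ⋆ 1#) * OPT R (line R) 3 C σ + 800 ⋆ 1#
  algorithm-competitive C σ with divide 39999 (A - c)
    where
    A = cost-of C (run R (line R) 3 algorithm C σ)
    c = 800 ⋆ 1#
  ... | w , 40000w = subst (λ o → A ≤ o + c) (sym (⋆1-* 40000 o))
    (linear 5 (λ A a c w o → w :≤ o ⇒ a :≤ 40000 :⋆ w ⇒ A :≤ a :+ c ⇒ ⊢ A :≤ 40000 :⋆ o :+ c)
      (40000 ∷ 1 ∷ 1 ∷ []) refl
      (proj₂ (proj₂ (OPT-infimum R (line R) 3 C σ)) w λ where
        _ (opt , refl) → linear 5 (λ A a c w k → A :≤ c :+ 40000 :⋆ k ⇒ a :+ c :≤ A ⇒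
          40000 :⋆ w :≤ a ⇒ ⊢ w :≤ k) (1 ∷ 1 ∷ 1 ∷ 39999 ∷ []) refl
          (algorithm-cost C σ opt) (≤-reflexive (minus-plus A c)) (≤-reflexive 40000w))
      (≤-reflexive (sym 40000w)) (≤-reflexive (sym (minus-plus A c))))
    where
    A = cost-of C (run R (line R) 3 algorithm C σ)
    c = 800 ⋆ 1#
    o = OPT R (line R) 3 C σ

-- Expectations over a one-point space.

module Deterministic (em : ExcludedMiddle 0ℓ) (R : Reals) where
  open Reals R
  open LinearArithmetic R
  open OrderedField R
  open IsCommutativeRing isCommutativeRing using (*-identityʳ; zeroʳ)

  indicator : ∀ {E : Set} → Dec E → ℝ
  indicator (yes _) = 1#
  indicator (no _)  = 0#

  indicator-mono : ∀ {E F : Set} → (E → F) → (e : Dec E) (f : Dec F) → indicator e ≤ indicator f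
  indicator-mono E⇒F (yes e) (yes f) = ≤-refl
  indicator-mono E⇒F (yes e) (no ¬f) = ⊥-elim (¬f (E⇒F e))
  indicator-mono E⇒F (no ¬e) (yes f) = 0≤1
  indicator-mono E⇒F (no ¬e) (no ¬f) = ≤-refl

  indicator-yes : ∀ {E : Set} (e : Dec E) → E → indicator e ≡ 1#
  indicator-yes (yes _) e = refl
  indicator-yes (no ¬e) e = ⊥-elim (¬e e)

  indicator-no : ∀ {E : Set} (e : Dec E) → ¬ E → indicator e ≡ 0#
  indicator-no (yes e) ¬e = ⊥-elim (¬e e)
  indicator-no (no _)  ¬e = refl

  indicator-nonNeg : ∀ {E : Set} (e : Dec E) → 0# ≤ indicator e
  indicator-nonNeg (yes _) = 0≤1
  indicator-nonNeg (no _)  = ≤-refl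

  sum-zero : ∀ {n} (v : Vector ℝ n) → (∀ i → v i ≡ 0#) → sum v ≡ 0#
  sum-zero {zero}  v v≡0 = refl
  sum-zero {suc n} v v≡0 =
    trans (cong₂ _+_ (v≡0 zero) (sum-zero (λ i → v (suc i)) (λ i → v≡0 (suc i)))) (+-identityˡ 0#)

  -- At most one E i holds, so at most one summand is nonzero.
  sum-disjoint : ∀ {n b} (E : Fin n → Set) (v : Vector ℝ n) → 0# ≤ b →
    (∀ {i j} → i ≢ j → E i → ¬ E j) → (∀ i → ¬ E i → v i ≡ 0#) → (∀ i → E i → v i ≤ b) →
    sum v ≤ b
  sum-disjoint {zero}  E v 0≤b disjoint out inside = 0≤b
  sum-disjoint {suc n} {b} E v 0≤b disjoint out inside with em {E zero}
  ... | yes e = subst (_≤ b) (sym (trans (cong (v zero +_)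
    (sum-zero (λ i → v (suc i)) (λ i → out (suc i) (disjoint (λ ()) e)))) (+-identityʳ (v zero))))
    (inside zero e)
  ... | no ¬e = subst (_≤ b) (sym (trans (cong (_+ sum (λ i → v (suc i))) (out zero ¬e)) (+-identityˡ _)))
    (sum-disjoint (λ i → E (suc i)) (λ i → v (suc i)) 0≤b
      (λ i≢j → disjoint (λ eq → i≢j (suc-injective eq))) (λ i → out (suc i)) (λ i → inside (suc i)))

  ≤-sum : ∀ {n} (v : Vector ℝ n) → (∀ i → 0# ≤ v i) → ∀ i → v i ≤ sum v
  ≤-sum v 0≤v zero =
    linear 2 (λ a b → :0 :≤ b ⇒ ⊢ a :≤ a :+ b) (1 ∷ []) refl
      (sum-nonNeg (λ i → v (suc i)) (λ i → 0≤v (suc i)))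
  ≤-sum v 0≤v (suc i) = linear 3 (λ a b c → :0 :≤ a ⇒ c :≤ b ⇒ ⊢ c :≤ a :+ b) (1 ∷ 1 ∷ []) refl
    (0≤v zero) (≤-sum (λ j → v (suc j)) (λ j → 0≤v (suc j)) i)

  prob : Pred ⊤ 0ℓ → ℝ
  prob E = indicator (em {E tt})

  prob-⋃ : (E : ℕ → Pred ⊤ 0ℓ) → (∀ {m n} → m ≢ n → E m ⊥ E n) →
    IsSupremum (λ s → ∃[ n ] s ≡ sum {n} (λ i → prob (E (toℕ i)))) (prob (⋃ ℕ E))
  prob-⋃ E disjoint = upper , least
    where
    Partial : Pred ℝ 0ℓ
    Partial s = ∃[ n ] s ≡ sum {n} (λ i → prob (E (toℕ i)))
    upper : UpperBound Partial (prob (⋃ ℕ E))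
    upper _ (n , refl) = sum-disjoint {n} (λ i → E (toℕ i) tt) _ (indicator-nonNeg em)
      (λ i≢j e f → disjoint (λ eq → i≢j (toℕ-injective eq)) (e , f))
      (λ i → indicator-no em) (λ i e → indicator-mono (λ e → toℕ i , e) em em)
    least : ∀ b → UpperBound Partial b → prob (⋃ ℕ E) ≤ b
    least b bounds with em {⋃ ℕ E tt}
    -- The probability is 0, the empty partial sum.
    ... | no _        = bounds 0# (0 , refl)
    ... | yes (m , e) = ≤-trans
      (≤-trans (≤-reflexive (sym (indicator-yes (em {E (toℕ (fromℕ m)) tt})
          (subst (λ k → E k tt) (sym (toℕ-fromℕ m)) e))))
        (≤-sum (λ i → prob (E (toℕ i))) (λ i → indicator-nonNeg em) (fromℕ m)))
      (bounds _ (suc m , refl))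

  onePoint : ProbabilitySpace R
  onePoint = record
    { Ω            = ⊤
    ; Measurable   = λ _ → ⊤
    ; P            = prob
    ; U-measurable = tt
    ; ∁-measurable = λ _ → tt
    ; ⋃-measurable = λ _ → tt
    ; ≐-measurable = λ _ _ → tt
    ; P-cong       = λ (E⊆F , F⊆E) _ → antisym (indicator-mono E⊆F em em) (indicator-mono F⊆E em em)
    ; P-nonNeg     = λ _ → indicator-nonNeg em
    ; P-U          = indicator-yes em tt
    ; P-⋃          = λ {E} _ → prob-⋃ E
    }

  open ProbabilitySpace onePoint using (LowerSum; IsExpectation)

  expectation : (X : ⊤ → ℝ) → 0# ≤ X tt → IsExpectation X (X tt)
  expectation X 0≤X = (λ _ → tt) , upper , least
    where
    upper : UpperBound (LowerSum X) (X tt)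
    upper _ (n , E , a , _ , disjoint , 0≤a , a≤X , refl) = sum-disjoint (λ i → E i tt) _ 0≤X
      (λ i≢j e f → disjoint i≢j (e , f))
      (λ i ¬e → trans (cong (a i *_) (indicator-no em ¬e)) (zeroʳ (a i)))
      (λ i e → subst (_≤ X tt)
        (sym (trans (cong (a i *_) (indicator-yes em e)) (*-identityʳ (a i)))) (a≤X i tt e))
    least : ∀ b → UpperBound (LowerSum X) b → X tt ≤ b
    -- X is itself simple: the coefficient `X tt` on the whole space attains the integral.
    least b bounds = bounds (X tt)
      (1 , (λ _ → U) , (λ _ → X tt) , (λ _ → tt) , (λ { {zero} {zero} i≢i → ⊥-elim (i≢i refl) }) ,
        (λ _ → 0≤X) , (λ _ _ _ → ≤-refl) ,
        sym (trans (+-identityʳ _) (trans (cong (X tt *_) (indicator-yes em tt)) (*-identityʳ (X tt)))))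

theorem5 : ExcludedMiddle 0ℓ → (R : Reals) → ∃[ ρ ] ∃[ A ] IsCompetitive R (line R) 3 ρ A
theorem5 em R = 40000 ⋆ 1# , record { space = onePoint ; sample = λ _ → algorithm } , λ C →
  800 ⋆ 1# , λ σ → _ , expectation _ (cost-nonNeg R (line R) 3 C (run R (line R) 3 algorithm C σ)) ,
  algorithm-competitive C σ
  where
  open Reals R
  open LinearArithmetic R
  open Algorithm em R
  open Deterministic em R
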